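{- For every formula $\varphi\in\mathrm{TeamLTL}(\lor_{\mathsf B},\sim\!\bot,\overset{1}{\mathsf A})$ there exists an equivalent $\mathrm{HyperQPTL}^+$-formula $\varphi^*$ in the $\exists_p\,\overset{u}{Q}{}_p^{*}\,\exists_\pi^*\,\forall_\pi$ fragment, i.e. such that for every team $(T,i)$: $(T,i)\models\varphi$ iff $\emptyset,i\models_T\varphi^*$. If $\varphi\in\mathrm{TeamLTL}(\lor_{\mathsf B},\overset{1}{\mathsf A})$, then $\varphi^*$ can be chosen in the $\exists_p\,\overset{u}{Q}{}_p^{*}\,\forall_\pi$ fragment. The size of $\varphi^*$ is linear with respect to the size of $\varphi$.
   Context: $\mathrm{AP}$ is a fixed set of atomic propositions, containing fresh propositions (not occurring in the formula at hand) whenever needed. A trace is an element of $(2^{\mathrm{AP}})^\omega$, and $t[i]$ is its $i$-th letter. A team is a pair $(T,i)$ with $T$ a set of traces and $i\in\mathbb N$. **Team logics.** TeamLTL formulae are $\varphi ::= p \mid \neg p \mid \varphi\lor\varphi \mid \varphi\land\varphi \mid \mathsf X\varphi \mid \varphi\,\mathsf U\,\varphi \mid \varphi\,\mathsf W\,\varphi$ ($p\in\mathrm{AP}$), $\bot:=p\land\neg p$, with semantics: - $(T,i)\models p$ iff $p\in t[i]$ for all $t\in T$; $(T,i)\models\neg p$ iff $p\notin t[i]$ for all $t\in T$; - $(T,i)\models\varphi\land\psi$ iff $(T,i)\models\varphi$ and $(T,i)\models\psi$; - $(T,i)\models\varphi\lor\psi$ iff there are $T_1,T_2$ with $T_1\cup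 T_2=T$, $(T_1,i)\models\varphi$ and $(T_2,i)\models\psi$; - $(T,i)\models\mathsf X\varphi$ iff $(T,i+1)\models\varphi$; - $(T,i)\models\varphi\,\mathsf U\,\psi$ iff there is $k\ge i$ with $(T,k)\models\psi$ and $(T,m)\models\varphi$ for all $i\le m<k$; - $(T,i)\models\varphi\,\mathsf W\,\psi$ iff for all $k\ge i$: $(T,k)\models\varphi$ or there is $m$ with $i\le m\le k$ and $(T,m)\models\psi$. The listed extensions add: Boolean disjunction, $(T,i)\models\varphi\lor_{\mathsf B}\psi$ iff $(T,i)\models\varphi$ or $(T,i)\models\psi$; the atom $\sim\!\bot$, $(T,i)\models\,\sim\!\bot$ iff $T\ne\emptyset$; and $(T,i)\models\overset{1}{\mathsf A}\varphi$ iff $(\{t\},i)\models\varphi$ for all $t\in T$. **$\mathrm{HyperQPTL}^+$.** With trace variables $\pi$ from an infinite set $\mathcal V$: $\varphi ::= \forall\pi.\varphi\mid\exists\pi.\varphi\mid\overset{u}{\forall}p.\varphi\mid\overset{u}{\exists}p.\varphi\mid\forall p.\varphi\mid\exists p.\varphi\mid\psi$, and $\psi ::= p_\pi\mid\neg p_\pi\mid\psi\lor\psi\mid\psi\land\psi\mid\mathsf X\psi\mid\psi\,\mathsf U\,\psi\mid\psi\,\mathsf W\,\psi$. Formulae are evaluated at a position $i$ with respect to a set $T$ of traces and a (possibly empty, $\emptyset$) trace assignment $\Pi$ mapping trace variables to traces of $T$: $\Pi,i\models_T p_\pi$ iff $p\in\Pi(\pi)[i]$; $\Pi,i\models_T\neg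 p_\pi$ iff $p\notin\Pi(\pi)[i]$; $\lor,\land$ are Boolean; $\mathsf X,\mathsf U,\mathsf W$ have their usual LTL meaning in the position $i$. Quantifiers: - $\exists\pi.\varphi$ ($\forall\pi.\varphi$): $\Pi[\pi\mapsto t],i\models_T\varphi$ for some (all) $t\in T$; - uniform propositional quantifiers $\overset{u}{\exists}p.\varphi$ ($\overset{u}{\forall}p.\varphi$): $\Pi[p\mapsto s],i\models_{T[p\mapsto s]}\varphi$ for some (all) $s\in(2^{\{p\}})^\omega$, where $T[p\mapsto s]$ and $\Pi[p\mapsto s]$ are obtained by reinterpreting $p$ on every trace as in $s$ and leaving all other propositions unchanged; - non-uniform propositional quantifiers $\exists p.\varphi$ ($\forall p.\varphi$): $\Pi',i\models_{T'}\varphi$ for some (all) $T'\subseteq(2^{\mathrm{AP}})^\omega$ and trace assignments $\Pi'$ into $T'$ such that $T$ and $T'$ have the same set of projections to $\mathrm{AP}\setminus\{p\}$, and for every trace variable $\pi$ the traces $\Pi(\pi)$ and $\Pi'(\pi)$ have the same projection to $\mathrm{AP}\setminus\{p\}$. Fragments are given by regular expressions for the quantifier prefix: $\exists_p$ is a non-uniform existential propositional quantifier, $\overset{u}{Q}{}_p$ is a uniform propositional quantifier (existential or universal), and $\exists_\pi,\forall_\pi$ are trace quantifiers.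
   Formalization: In the first sentence, φ implies φ* is claimed only for teams with T nonempty (φ* implies φ for all teams), as equivalence on the empty team fails, e.g. for r ∨_B ((q ∧ ∼⊥) ∨ s); the second sentence keeps full equivalence on all teams. -}

module Defs where

open import Data.Bool.Base using (Bool; true; false; if_then_else_)
open import Data.List.Base using (List; []; _∷_; [_]; _++_; replicate)
open import Data.List.Membership.Propositional using (_∈_; _∉_)
open import Data.List.Relation.Unary.All using (All)
open import Data.Maybe.Base as Maybe using (Maybe; just; nothing)
open import Data.Maybe.Relation.Binary.Pointwise using (Pointwise)
open import Data.Maybe.Relation.Unary.All as MaybeAll using ()
open import Data.Maybe.Relation.Unary.Any as MaybeAny using ()
open import Data.Empty using (⊥)
open import Data.Unit.Base using (⊤)
open import Data.Nat.Base using (ℕ; suc; _+_; _≤_; _<_)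
open import Data.Product.Base using (_×_; _,_; ∃-syntax; Σ-syntax)
open import Data.Sum.Base using (_⊎_)
open import Level using (Lift; 0ℓ) renaming (suc to lsuc)
open import Relation.Binary.Core using (Rel)
open import Relation.Binary.Definitions using (DecidableEquality; _Respects_)
open import Relation.Binary.PropositionalEquality using (_≡_; _≢_; refl; sym; trans)
open import Relation.Nullary.Decidable.Core using (does)
open import Relation.Unary using (Pred; _∪_; _≐_; Satisfiable)

Infinite : Set → Set
Infinite A = (xs : List A) → ∃[ x ] x ∉ xs

module Logic
  (AP 𝒱 : Set) (_≟ᴬ_ : DecidableEquality AP) (_≟ⱽ_ : DecidableEquality 𝒱)
  where

  Trace : Set
  Trace = ℕ → AP → Bool

  -- Without function extensionality, equality of traces is pointwise
  -- equality, and a set of traces is a predicate respecting it.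

  infix 4 _≈_ _≈[_]_

  _≈_ : Rel Trace 0ℓ
  t ≈ t′ = ∀ i p → t i p ≡ t′ i p

  -- Equality of the projections to AP ∖ {p}.
  _≈[_]_ : Trace → AP → Trace → Set
  t ≈[ p ] t′ = ∀ i q → q ≢ p → t i q ≡ t′ i q

  record TraceSet : Set₁ where
    field
      member   : Pred Trace 0ℓ
      respects : member Respects _≈_
  open TraceSet public

  Nonempty : TraceSet → Set
  Nonempty T = Satisfiable (member T)

  ｛_｝ : Trace → TraceSet
  ｛ t ｝ .member u       = u ≈ t
  ｛ t ｝ .respects e u≈t i p = trans (sym (e i p)) (u≈t i p)

  infixr 7 _∧_
  infixr 6 _∨_ _∨ᴮ_
  infixr 8 _U_ _W_

  data TeamLTL : Set where
    pos neg             : AP → TeamLTL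
    _∨_ _∧_ _U_ _W_     : TeamLTL → TeamLTL → TeamLTL
    X                   : TeamLTL → TeamLTL
    _∨ᴮ_                : TeamLTL → TeamLTL → TeamLTL
    ∼⊥                  : TeamLTL
    A¹                  : TeamLTL → TeamLTL

  infix 3 ⟨_,_⟩⊨_

  ⟨_,_⟩⊨_ : TraceSet → ℕ → TeamLTL → Set₁
  ⟨ T , i ⟩⊨ pos p    = Lift (lsuc 0ℓ) (∀ t → member T t → t i p ≡ true)
  ⟨ T , i ⟩⊨ neg p    = Lift (lsuc 0ℓ) (∀ t → member T t → t i p ≡ false)
  ⟨ T , i ⟩⊨ (φ ∨ ψ)  = Σ[ T₁ ∈ TraceSet ] Σ[ T₂ ∈ TraceSet ]
                          (member T₁ ∪ member T₂) ≐ member T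
                          × (⟨ T₁ , i ⟩⊨ φ) × (⟨ T₂ , i ⟩⊨ ψ)
  ⟨ T , i ⟩⊨ (φ ∧ ψ)  = (⟨ T , i ⟩⊨ φ) × (⟨ T , i ⟩⊨ ψ)
  ⟨ T , i ⟩⊨ X φ      = ⟨ T , suc i ⟩⊨ φ
  ⟨ T , i ⟩⊨ (φ U ψ)  = ∃[ k ] i ≤ k × (⟨ T , k ⟩⊨ ψ)
                          × (∀ m → i ≤ m → m < k → ⟨ T , m ⟩⊨ φ)
  ⟨ T , i ⟩⊨ (φ W ψ)  = ∀ k → i ≤ k →
                          (⟨ T , k ⟩⊨ φ) ⊎ (∃[ m ] i ≤ m × m ≤ k × (⟨ T , m ⟩⊨ ψ))
  ⟨ T , i ⟩⊨ (φ ∨ᴮ ψ) = (⟨ T , i ⟩⊨ φ) ⊎ (⟨ T , i ⟩⊨ ψ)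
  ⟨ T , i ⟩⊨ ∼⊥       = Lift (lsuc 0ℓ) (Nonempty T)
  ⟨ T , i ⟩⊨ A¹ φ     = ∀ t → member T t → ⟨ ｛ t ｝ , i ⟩⊨ φ

  -- Membership in TeamLTL(∨ᴮ, A¹); TeamLTL itself is TeamLTL(∨ᴮ, ∼⊥, A¹).
  ∼⊥-Free : TeamLTL → Set
  ∼⊥-Free (pos p)  = ⊤
  ∼⊥-Free (neg p)  = ⊤
  ∼⊥-Free (φ ∨ ψ)  = ∼⊥-Free φ × ∼⊥-Free ψ
  ∼⊥-Free (φ ∧ ψ)  = ∼⊥-Free φ × ∼⊥-Free ψ
  ∼⊥-Free (φ U ψ)  = ∼⊥-Free φ × ∼⊥-Free ψ
  ∼⊥-Free (φ W ψ)  = ∼⊥-Free φ × ∼⊥-Free ψ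
  ∼⊥-Free (X φ)    = ∼⊥-Free φ
  ∼⊥-Free (φ ∨ᴮ ψ) = ∼⊥-Free φ × ∼⊥-Free ψ
  ∼⊥-Free ∼⊥       = ⊥
  ∼⊥-Free (A¹ φ)   = ∼⊥-Free φ

  size : TeamLTL → ℕ
  size (pos p)  = 1
  size (neg p)  = 1
  size (φ ∨ ψ)  = suc (size φ + size ψ)
  size (φ ∧ ψ)  = suc (size φ + size ψ)
  size (φ U ψ)  = suc (size φ + size ψ)
  size (φ W ψ)  = suc (size φ + size ψ)
  size (X φ)    = suc (size φ)
  size (φ ∨ᴮ ψ) = suc (size φ + size ψ)
  size ∼⊥       = 1
  size (A¹ φ)   = suc (size φ)

  data Body : Set where
    pos neg         : AP → 𝒱 → Body
    _∨_ _∧_ _U_ _W_ : Body → Body → Body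
    X               : Body → Body

  -- The superscript u marks the uniform quantifiers.
  data Quantifier : Set where
    ∀π ∃π           : Quantifier
    ∀ᵘp ∃ᵘp ∀p ∃p   : Quantifier

  Bound : Quantifier → Set
  Bound ∀π  = 𝒱
  Bound ∃π  = 𝒱
  Bound ∀ᵘp = AP
  Bound ∃ᵘp = AP
  Bound ∀p  = AP
  Bound ∃p  = AP

  infixr 5 _·_∙_

  data HyperQPTL⁺ : Set where
    _·_∙_ : (Q : Quantifier) → Bound Q → HyperQPTL⁺ → HyperQPTL⁺
    body  : Body → HyperQPTL⁺

  sizeᴮ : Body → ℕ
  sizeᴮ (pos p π) = 1
  sizeᴮ (neg p π) = 1
  sizeᴮ (φ ∨ ψ)   = suc (sizeᴮ φ + sizeᴮ ψ)
  sizeᴮ (φ ∧ ψ)   = suc (sizeᴮ φ + sizeᴮ ψ)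
  sizeᴮ (φ U ψ)   = suc (sizeᴮ φ + sizeᴮ ψ)
  sizeᴮ (φ W ψ)   = suc (sizeᴮ φ + sizeᴮ ψ)
  sizeᴮ (X φ)     = suc (sizeᴮ φ)

  sizeᴴ : HyperQPTL⁺ → ℕ
  sizeᴴ (Q · x ∙ φ) = suc (sizeᴴ φ)
  sizeᴴ (body ψ)    = sizeᴮ ψ

  infix 9 _[_↦_] _[_↦_]ᵀ _[_↦_]ᴬ _[_:=_]

  _[_↦_] : Trace → AP → (ℕ → Bool) → Trace
  (t [ p ↦ s ]) i q = if does (q ≟ᴬ p) then s i else t i q

  _[_↦_]ᵀ : TraceSet → AP → (ℕ → Bool) → TraceSet
  (T [ p ↦ s ]ᵀ) .member u = ∃[ t ] member T t × u ≈ t [ p ↦ s ]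
  (T [ p ↦ s ]ᵀ) .respects e (t , t∈T , u≈) =
    t , t∈T , λ i q → trans (sym (e i q)) (u≈ i q)

  -- Assignments are partial; undefined variables are sent to nothing.
  Assignment : Set
  Assignment = 𝒱 → Maybe Trace

  ∅ : Assignment
  ∅ π = nothing

  _[_:=_] : Assignment → 𝒱 → Trace → Assignment
  (Π [ π := t ]) π′ = if does (π′ ≟ⱽ π) then just t else Π π′

  _[_↦_]ᴬ : Assignment → AP → (ℕ → Bool) → Assignment
  (Π [ p ↦ s ]ᴬ) π = Maybe.map _[ p ↦ s ] (Π π)

  _Into_ : Assignment → TraceSet → Set
  Π Into T = ∀ π → MaybeAll.All (member T) (Π π)

  -- (T′ , Π′) is one of the pairs over which the non-uniform quantifiers
  -- for p range when evaluated at (T , Π).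
  record Variant (p : AP) (T : TraceSet) (Π : Assignment)
                 (T′ : TraceSet) (Π′ : Assignment) : Set where
    field
      into     : Π′ Into T′
      forth    : ∀ t → member T t → ∃[ t′ ] member T′ t′ × t ≈[ p ] t′
      back     : ∀ t′ → member T′ t′ → ∃[ t ] member T t × t ≈[ p ] t′
      assigned : ∀ π → Pointwise _≈[ p ]_ (Π π) (Π′ π)

  infix 3 ⟨_,_⟩⊨ᴮ_ ⟨_,_⟩⊨[_]_

  -- Atoms on undefined variables are false; closed formulae never
  -- evaluate them.
  ⟨_,_⟩⊨ᴮ_ : Assignment → ℕ → Body → Set
  ⟨ Π , i ⟩⊨ᴮ pos p π = MaybeAny.Any (λ t → t i p ≡ true) (Π π)
  ⟨ Π , i ⟩⊨ᴮ neg p π = MaybeAny.Any (λ t → t i p ≡ false) (Π π)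
  ⟨ Π , i ⟩⊨ᴮ (φ ∨ ψ) = (⟨ Π , i ⟩⊨ᴮ φ) ⊎ (⟨ Π , i ⟩⊨ᴮ ψ)
  ⟨ Π , i ⟩⊨ᴮ (φ ∧ ψ) = (⟨ Π , i ⟩⊨ᴮ φ) × (⟨ Π , i ⟩⊨ᴮ ψ)
  ⟨ Π , i ⟩⊨ᴮ X φ     = ⟨ Π , suc i ⟩⊨ᴮ φ
  ⟨ Π , i ⟩⊨ᴮ (φ U ψ) = ∃[ k ] i ≤ k × (⟨ Π , k ⟩⊨ᴮ ψ)
                          × (∀ m → i ≤ m → m < k → ⟨ Π , m ⟩⊨ᴮ φ)
  ⟨ Π , i ⟩⊨ᴮ (φ W ψ) = ∀ k → i ≤ k →
                          (⟨ Π , k ⟩⊨ᴮ φ) ⊎ (∃[ m ] i ≤ m × m ≤ k × (⟨ Π , m ⟩⊨ᴮ ψ))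

  ⟨_,_⟩⊨[_]_ : Assignment → ℕ → TraceSet → HyperQPTL⁺ → Set₁
  ⟨ Π , i ⟩⊨[ T ] (∀π · π ∙ φ)  = ∀ t → member T t → ⟨ Π [ π := t ] , i ⟩⊨[ T ] φ
  ⟨ Π , i ⟩⊨[ T ] (∃π · π ∙ φ)  = ∃[ t ] member T t × (⟨ Π [ π := t ] , i ⟩⊨[ T ] φ)
  ⟨ Π , i ⟩⊨[ T ] (∀ᵘp · p ∙ φ) = ∀ s → ⟨ Π [ p ↦ s ]ᴬ , i ⟩⊨[ T [ p ↦ s ]ᵀ ] φ
  ⟨ Π , i ⟩⊨[ T ] (∃ᵘp · p ∙ φ) = ∃[ s ] (⟨ Π [ p ↦ s ]ᴬ , i ⟩⊨[ T [ p ↦ s ]ᵀ ] φ)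
  ⟨ Π , i ⟩⊨[ T ] (∀p · p ∙ φ)  = ∀ T′ Π′ → Variant p T Π T′ Π′ → ⟨ Π′ , i ⟩⊨[ T′ ] φ
  ⟨ Π , i ⟩⊨[ T ] (∃p · p ∙ φ)  = Σ[ T′ ∈ TraceSet ] Σ[ Π′ ∈ Assignment ]
                                    Variant p T Π T′ Π′ × (⟨ Π′ , i ⟩⊨[ T′ ] φ)
  ⟨ Π , i ⟩⊨[ T ] body ψ        = Lift (lsuc 0ℓ) (⟨ Π , i ⟩⊨ᴮ ψ)

  ScopedBody : List 𝒱 → Body → Set
  ScopedBody Γ (pos p π) = π ∈ Γ
  ScopedBody Γ (neg p π) = π ∈ Γ
  ScopedBody Γ (φ ∨ ψ)   = ScopedBody Γ φ × ScopedBody Γ ψ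
  ScopedBody Γ (φ ∧ ψ)   = ScopedBody Γ φ × ScopedBody Γ ψ
  ScopedBody Γ (φ U ψ)   = ScopedBody Γ φ × ScopedBody Γ ψ
  ScopedBody Γ (φ W ψ)   = ScopedBody Γ φ × ScopedBody Γ ψ
  ScopedBody Γ (X φ)     = ScopedBody Γ φ

  Scoped : List 𝒱 → HyperQPTL⁺ → Set
  Scoped Γ (∀π · π ∙ φ)  = Scoped (π ∷ Γ) φ
  Scoped Γ (∃π · π ∙ φ)  = Scoped (π ∷ Γ) φ
  Scoped Γ (∀ᵘp · p ∙ φ) = Scoped Γ φ
  Scoped Γ (∃ᵘp · p ∙ φ) = Scoped Γ φ
  Scoped Γ (∀p · p ∙ φ)  = Scoped Γ φ
  Scoped Γ (∃p · p ∙ φ)  = Scoped Γ φ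
  Scoped Γ (body ψ)      = ScopedBody Γ ψ

  Closed : HyperQPTL⁺ → Set
  Closed φ = Scoped [] φ

  prefix : HyperQPTL⁺ → List Quantifier
  prefix (Q · x ∙ φ) = Q ∷ prefix φ
  prefix (body ψ)    = []

  data Uniform : Quantifier → Set where
    ∀ᵘp : Uniform ∀ᵘp
    ∃ᵘp : Uniform ∃ᵘp

  ∃ₚQᵘₚ*∃π*∀π : HyperQPTL⁺ → Set
  ∃ₚQᵘₚ*∃π*∀π φ = ∃[ us ] ∃[ n ] All Uniform us
                    × prefix φ ≡ [ ∃p ] ++ us ++ replicate n ∃π ++ [ ∀π ]

  ∃ₚQᵘₚ*∀π : HyperQPTL⁺ → Set
  ∃ₚQᵘₚ*∀π φ = ∃[ us ] All Uniform us × prefix φ ≡ [ ∃p ] ++ us ++ [ ∀π ]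

{-# OPTIONS --safe #-}

-- One non-uniformly quantified proposition p on the traces of T encodes a
-- sequence of subteams of T: the r-th one consists of the traces on which p
-- holds at position r.  Only countably many subteams arise when φ is evaluated
-- on T, so a single p stores them all.  Every subformula gets a uniform
-- proposition labelling positions at which it is claimed to hold for the
-- current subteam; then ∧, ∨ᴮ, X, U and W are LTL conditions on labels.  A
-- split ∨ is a game on uniform propositions: ∀ chooses a labelled position, ∃
-- answers with the columns of p that hold the two halves.  On singletons team
-- formulas are LTL formulas, which takes care of atoms and A¹.  An occurrence
-- of ∼⊥ is a trace quantifier ∃π; it is vacuous at an empty label, but still
-- needs some trace in T.
module Submission where

open import Defs
open import Axiom.ExcludedMiddle using (ExcludedMiddle)
open import Data.Bool.Base as Bool using (Bool; true; false; if_then_else_)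
open import Data.Bool.Properties using (¬-not)
open import Data.Empty using (⊥; ⊥-elim)
open import Data.List.Base using (List; []; _∷_; [_]; _++_; replicate; length; map)
open import Data.List.Membership.Propositional using (_∈_; _∉_)
open import Data.List.Membership.Propositional.Properties using (∈-++⁺ˡ; ∈-++⁺ʳ)
open import Data.List.Properties using (++-conicalˡ; ++-conicalʳ; length-++)
open import Data.List.Relation.Unary.All using (All; []; _∷_)
open import Data.List.Relation.Unary.All.Properties using (++⁺; ++⁻ˡ; ++⁻ʳ)
open import Data.List.Relation.Unary.Any using (here; there)
open import Data.Maybe.Base using (just; nothing)
open import Data.Maybe.Relation.Binary.Pointwise using (nothing)
open import Data.Maybe.Relation.Unary.All using (nothing)
open import Data.Maybe.Relation.Unary.Any as MaybeAny using (just)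
open import Data.Nat.Base using (ℕ; zero; suc; _≤_; _*_; _<_; _+_; _∸_; z≤n; s≤s)
open import Data.Nat.Properties
open import Data.Nat.Tactic.RingSolver using (solve-∀)
open import Data.Product.Base using (_×_; ∃-syntax; _,_; Σ-syntax; proj₁; proj₂)
open import Data.Sum.Base as Sum using (_⊎_; inj₁; inj₂)
open import Data.Unit.Base using (⊤; tt)
open import Function.Base using (_∘_; const; id)
open import Function.Bundles using (_⇔_; mk⇔; module Equivalence)
open import Level using (Level; 0ℓ; Lift; lift; lower) renaming (suc to lsuc)
open import Relation.Binary.Definitions using (DecidableEquality)
open import Relation.Binary.PropositionalEquality
  using (_≡_; _≢_; refl; sym; trans; cong; cong₂; subst)
open import Relation.Nullary.Decidable using (Dec; yes; no; does; map′; dec-true; dec-false)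
open import Relation.Nullary.Negation using (¬_; contradiction)
open import Relation.Unary.Algebra using (∪-idem)
open import Relation.Unary using (Satisfiable; _∪_; _≐_; _⊆_)

open Equivalence using (to; from)

-- A label can be infinite, and each of its positions may need a split of its own, while the prefix
-- has fixed length. Quantifying universally over the position is what reduces this to two columns
-- per occurrence of `∨`. The columns themselves cannot wait for the challenge, because `p` is
-- quantified first: the splits at all positions are fixed beforehand, then those of the halves, and
-- so on down the formula, a tree of finite depth and countable branching. Prenexing is the other
-- obstacle. The games of two subformulas become consecutive blocks of one prefix, with a common
-- check at the very end. Soundness therefore assumes only that some continuation of a play passes
-- the check, whereas completeness shows that every continuation does. One `∀π` suffices because no
-- clause compares traces: each speaks of a single trace and of uniform propositions, whose values
-- all traces share.

private
  variable
    ℓ ℓ₁ ℓ₂ : Level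

does⇒ : {P : Set ℓ} (P? : Dec P) → does P? ≡ true → P
does⇒ (yes p) _ = p

≤-node : ∀ c k x y {a b} → k ≤ c → a ≤ c * x → b ≤ c * y → k + (a + b) ≤ c * suc (x + y)
≤-node c k x y k≤ a≤ b≤ = ≤-trans (+-mono-≤ k≤ (+-mono-≤ a≤ b≤))
  (≤-reflexive (sym (trans (*-suc c (x + y)) (cong (c +_) (*-distribˡ-+ c x y)))))

≤-stem : ∀ c k x {a} → k ≤ c → a ≤ c * x → k + a ≤ c * suc x
≤-stem c k x k≤ a≤ = ≤-trans (+-mono-≤ k≤ a≤) (≤-reflexive (sym (*-suc c x)))

-- Infinite supplies of fresh names.

module _ {A : Set} (fresh : Infinite A) (avoided : List A) where

  names : ℕ → List A
  names zero    = avoided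
  names (suc n) = proj₁ (fresh (names n)) ∷ names n

  name : ℕ → A
  name n = proj₁ (fresh (names n))

  avoided⊆names : ∀ {x} n → x ∈ avoided → x ∈ names n
  avoided⊆names zero    x∈ = x∈
  avoided⊆names (suc n) x∈ = there (avoided⊆names n x∈)

  name∉avoided : ∀ n → name n ∉ avoided
  name∉avoided n x∈ = proj₂ (fresh (names n)) (avoided⊆names n x∈)

  earlier∈names : ∀ {m} n → m < n → name m ∈ names n
  earlier∈names (suc n) m<sn with m<1+n⇒m<n∨m≡n m<sn
  ... | inj₁ m<n  = there (earlier∈names n m<n)
  ... | inj₂ refl = here refl

  name-distinct : ∀ {m n} → m < n → name m ≢ name n
  name-distinct {n = n} m<n eq =
    proj₂ (fresh (names n)) (subst (_∈ names n) eq (earlier∈names n m<n))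

-- Countable families and their merging.

-- Walks through ℕ × ℕ along the antidiagonals.
unpair : ℕ → ℕ × ℕ
unpair zero    = 0 , 0
unpair (suc n) with unpair n
... | x , zero  = 0 , suc x
... | x , suc y = suc x , y

unpair-next : ∀ n {x y} → unpair n ≡ (x , suc y) → unpair (suc n) ≡ (suc x , y)
unpair-next n eq with unpair n
unpair-next n refl | _ = refl

unpair-wrap : ∀ n {x} → unpair n ≡ (x , 0) → unpair (suc n) ≡ (0 , suc x)
unpair-wrap n eq with unpair n
unpair-wrap n refl | _ = refl

unpair-surjective : ∀ x y → ∃[ n ] unpair n ≡ (x , y)
unpair-surjective x y = diagonal (x + y) x y refl
  where
  diagonal : ∀ d x y → x + y ≡ d → ∃[ n ] unpair n ≡ (x , y)
  diagonal zero    zero    zero    _  = 0 , refl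
  diagonal (suc d) zero    (suc y) eq with diagonal d y 0 (trans (+-identityʳ y) (suc-injective eq))
  ... | n , n↦ = suc n , unpair-wrap n n↦
  diagonal d       (suc x) y       eq with diagonal d x (suc y) (trans (+-suc x y) eq)
  ... | n , n↦ = suc n , unpair-next n n↦

infixr 5 _◂_

_◂_ : {A : Set ℓ} → A → (ℕ → A) → ℕ → A
(x ◂ G) zero    = x
(x ◂ G) (suc n) = G n

module _ {ℓ : Level} {A : Set ℓ} where

  infixr 5 _⊕_

  _Covers_ : (ℕ → A) → (ℕ → A) → Set ℓ
  F Covers G = ∀ b → ∃[ a ] F a ≡ G b

  ⨁ : (ℕ → ℕ → A) → ℕ → A
  ⨁ H n = H (proj₁ (unpair n)) (proj₂ (unpair n))

  -- Row 0 is `G₁` and every other row is `G₂`; the repeated copies are harmless, since `_Covers_`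
  -- asks only which values occur.
  _⊕_ : (ℕ → A) → (ℕ → A) → ℕ → A
  G₁ ⊕ G₂ = ⨁ (G₁ ◂ const G₂)

  covers-⨁ : ∀ {F} H → F Covers ⨁ H → ∀ j → F Covers H j
  covers-⨁ H cov j b with unpair-surjective j b
  ... | n , n↦ with cov n
  ...   | a , eq = a , trans eq (cong (λ jb → H (proj₁ jb) (proj₂ jb)) n↦)

  covers-⊕ˡ : ∀ {F} G₁ G₂ → F Covers (G₁ ⊕ G₂) → F Covers G₁
  covers-⊕ˡ G₁ G₂ cov = covers-⨁ (G₁ ◂ const G₂) cov 0

  covers-⊕ʳ : ∀ {F} G₁ G₂ → F Covers (G₁ ⊕ G₂) → F Covers G₂
  covers-⊕ʳ G₁ G₂ cov = covers-⨁ (G₁ ◂ const G₂) cov 1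

-- Binary connectives shared by all the logics.

data Op : Set where
  and or until weak : Op

⟦_⟧ : Op → (P Q : ℕ → Set ℓ) → ℕ → Set ℓ
⟦ and ⟧   P Q i = P i × Q i
⟦ or ⟧    P Q i = P i ⊎ Q i
⟦ until ⟧ P Q i = ∃[ k ] i ≤ k × Q k × (∀ m → i ≤ m → m < k → P m)
⟦ weak ⟧  P Q i = ∀ k → i ≤ k → P k ⊎ (∃[ m ] i ≤ m × m ≤ k × Q m)

-- An operator evaluated at `i` inspects no earlier position, so the premises are restricted to
-- `i ≤ j`; labels are trusted only from the evaluation position on. The two levels differ because
-- team satisfaction lives in `Set₁` and labels in `Set`.
⟦_⟧-map : ∀ o {i} {P Q : ℕ → Set ℓ₁} {P′ Q′ : ℕ → Set ℓ₂} →
  (∀ j → i ≤ j → P j → P′ j) → (∀ j → i ≤ j → Q j → Q′ j) →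
  ⟦ o ⟧ P Q i → ⟦ o ⟧ P′ Q′ i
⟦ and ⟧-map   f g (p , q)             = f _ ≤-refl p , g _ ≤-refl q
⟦ or ⟧-map    f g (inj₁ p)            = inj₁ (f _ ≤-refl p)
⟦ or ⟧-map    f g (inj₂ q)            = inj₂ (g _ ≤-refl q)
⟦ until ⟧-map f g (k , i≤k , q , ps)  = k , i≤k , g k i≤k q , λ m i≤m m<k → f m i≤m (ps m i≤m m<k)
⟦ weak ⟧-map  f g w k i≤k with w k i≤k
... | inj₁ p                  = inj₁ (f k i≤k p)
... | inj₂ (m , i≤m , m≤k , q) = inj₂ (m , i≤m , m≤k , g m i≤m q)

-- The value of an operator whose arguments do not depend on the position: `until` can stop at once,
-- so only its right argument counts, and `weak` reduces to a disjunction.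
constᴼ : Op → Bool → Bool → Bool
constᴼ and   a b = a Bool.∧ b
constᴼ or    a b = a Bool.∨ b
constᴼ until a b = b
constᴼ weak  a b = a Bool.∨ b

const⇒ : ∀ o a b i → ⟦ o ⟧ (λ _ → a ≡ true) (λ _ → b ≡ true) i → constᴼ o a b ≡ true
const⇒ and   true  true  i _        = refl
const⇒ and   true  false i (_ , ())
const⇒ and   false _     i (() , _)
const⇒ or    true  b     i _        = refl
const⇒ or    false b     i (inj₂ q) = q
const⇒ until a     b     i (_ , _ , q , _) = q
const⇒ weak  true  b     i _        = refl
const⇒ weak  false b     i w with w i ≤-refl
... | inj₂ (_ , _ , _ , q) = q

const⇐ : ∀ o a b i → constᴼ o a b ≡ true → ⟦ o ⟧ (λ _ → a ≡ true) (λ _ → b ≡ true) i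
const⇐ and   true  true  i _ = refl , refl
const⇐ or    true  b     i _ = inj₁ refl
const⇐ or    false b     i q = inj₂ q
const⇐ until a     b     i q = i , ≤-refl , q , λ m i≤m m<i → contradiction i≤m (<⇒≱ m<i)
const⇐ weak  true  b     i _ k i≤k = inj₁ refl
const⇐ weak  false b     i q k i≤k = inj₂ (i , ≤-refl , i≤k , q)

-- Games over a prefix of uniform quantifiers.

Env : Set
Env = ℕ → ℕ → Bool

infix 9 _[_≔_]

_[_≔_] : Env → ℕ → (ℕ → Bool) → Env
(e [ n ≔ s ]) k = if does (k ≟ n) then s else e k

infix 4 _⊑[_]_

record _⊑[_]_ (e : Env) (n : ℕ) (e′ : Env) : Set where
  field
    agree : ∀ {k} → k < n → e k ≡ e′ k
open _⊑[_]_

⊑-refl : ∀ {n e} → e ⊑[ n ] e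
⊑-refl .agree _ = refl

⊑-trans : ∀ {n e e′ e″} → e ⊑[ n ] e′ → e′ ⊑[ n ] e″ → e ⊑[ n ] e″
⊑-trans p q .agree k< = trans (p .agree k<) (q .agree k<)

⊑-weaken : ∀ {m n e e′} → m ≤ n → e ⊑[ n ] e′ → e ⊑[ m ] e′
⊑-weaken m≤n p .agree k< = p .agree (<-≤-trans k< m≤n)

≔-other : ∀ {e s k n} → k ≢ n → e k ≡ (e [ n ≔ s ]) k
≔-other {k = k} {n} k≢n rewrite dec-false (k ≟ n) k≢n = refl

≔-here : ∀ e {s} n → (e [ n ≔ s ]) n ≡ s
≔-here e n rewrite dec-true (n ≟ n) refl = refl

⊑-≔ : ∀ {n e s} → e ⊑[ n ] e [ n ≔ s ]
⊑-≔ {e = e} .agree k<n = ≔-other {e} (<⇒≢ k<n)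

⊑-step : ∀ {n e s e′} → e [ n ≔ s ] ⊑[ suc n ] e′ → e ⊑[ n ] e′
⊑-step le = ⊑-trans ⊑-≔ (⊑-weaken (n≤1+n _) le)

-- In a prefix of uniform quantifiers true stands for ∃, and the variables
-- n, n + 1, … are bound in order.
play : List Bool → ℕ → (Env → Set ℓ) → Env → Set ℓ
play []           n P e = P e
play (true ∷ qs)  n P e = ∃[ s ] play qs (suc n) P (e [ n ≔ s ])
play (false ∷ qs) n P e = ∀ s → play qs (suc n) P (e [ n ≔ s ])

infixl 6 _▷_

_▷_ : ℕ → List Bool → ℕ
n ▷ []       = n
n ▷ (q ∷ qs) = suc n ▷ qs

▷-++ : ∀ n qs rs → n ▷ (qs ++ rs) ≡ n ▷ qs ▷ rs
▷-++ n []       rs = refl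
▷-++ n (q ∷ qs) rs = ▷-++ (suc n) qs rs

▷-increasing : ∀ n qs → n ≤ n ▷ qs
▷-increasing n []       = ≤-refl
▷-increasing n (q ∷ qs) = ≤-trans (n≤1+n n) (▷-increasing (suc n) qs)

-- Prenexing: the moves of the second block are chosen once the outcome `e′` of the first is known,
-- so its strategy may depend on `e′`.
play-bind : ∀ qs {rs n e} {P : Env → Set ℓ₁} {Q : Env → Set ℓ₂} →
  play qs n P e →
  (∀ e′ → e ⊑[ n ] e′ → P e′ → play rs (n ▷ qs) Q e′) →
  play (qs ++ rs) n Q e
play-bind []           w       f = f _ ⊑-refl w
play-bind (true ∷ qs)  (s , w) f = s , play-bind qs w (λ e′ le → f e′ (⊑-step le))
play-bind (false ∷ qs) w       f = λ s → play-bind qs (w s) (λ e′ le → f e′ (⊑-step le))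

play-map : ∀ qs {n e} {P : Env → Set ℓ₁} {Q : Env → Set ℓ₂} →
  (∀ e′ → e ⊑[ n ] e′ → P e′ → Q e′) → play qs n P e → play qs n Q e
play-map []           f w       = f _ ⊑-refl w
play-map (true ∷ qs)  f (s , w) = s , play-map qs (λ e′ le → f e′ (⊑-step le)) w
play-map (false ∷ qs) f w       = λ s → play-map qs (λ e′ le → f e′ (⊑-step le)) (w s)

play-outcome : ∀ qs {n e} {P : Env → Set ℓ} → play qs n P e → ∃[ e′ ] e ⊑[ n ] e′ × P e′
play-outcome []           w       = _ , ⊑-refl , w
play-outcome (true ∷ qs)  (s , w) with play-outcome qs w
... | e′ , le , p = e′ , ⊑-step le , p
-- Any challenge will do, as only one completed play is wanted.
play-outcome (false ∷ qs) w       with play-outcome qs (w (const false))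
... | e′ , le , p = e′ , ⊑-step le , p

play-++ : ∀ qs {rs n e} {P : Env → Set ℓ} →
  play (qs ++ rs) n P e → play qs n (play rs (n ▷ qs) P) e
play-++ []           w       = w
play-++ (true ∷ qs)  (s , w) = s , play-++ qs w
play-++ (false ∷ qs) w       = λ s → play-++ qs (w s)

-- When the block of a subformula ends, moves for later variables are still to come. Soundness may
-- assume `R` only in some continuation, and completeness has to deliver it in all of them.
Above Within : ℕ → (Env → Set) → Env → Set
Above  n R e = ∃[ e′ ] e ⊑[ n ] e′ × R e′
Within n R e = ∀ e′ → e ⊑[ n ] e′ → R e′

-- Played out against arbitrary challenges, the second block amounts to a mere extension of the
-- environment, which `Above` absorbs.
play-aboveˡ : ∀ qs rs {n e R} → play (qs ++ rs) n (Above (n ▷ (qs ++ rs)) R) e →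
  play qs n (Above (n ▷ qs) R) e
play-aboveˡ qs rs {n} {R = R} w = play-map qs collapse (play-++ qs w)
  where
  collapse : ∀ e′ → _ → play rs (n ▷ qs) (Above (n ▷ (qs ++ rs)) R) e′ → Above (n ▷ qs) R e′
  collapse e′ _ w′ with play-outcome rs w′
  ... | e″ , le , e‴ , le′ , r =
    e‴ , ⊑-trans le (⊑-weaken (≤-trans (▷-increasing (n ▷ qs) rs) (≤-reflexive (sym (▷-++ n qs rs)))) le′) , r

-- Here the first block is played out against arbitrary challenges, which leaves one environment
-- from which the second block is still a full game.
play-aboveʳ : ∀ qs rs {n e R} → play (qs ++ rs) n (Above (n ▷ (qs ++ rs)) R) e →
  ∃[ e′ ] e ⊑[ n ] e′ × play rs (n ▷ qs) (Above (n ▷ qs ▷ rs) R) e′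
play-aboveʳ qs rs {n} {R = R} w rewrite ▷-++ n qs rs = play-outcome qs (play-++ qs w)

play-within : ∀ qs rs {n e} {R₁ R₂ : Env → Set} →
  play qs n (Within (n ▷ qs) R₁) e →
  (∀ e′ → e ⊑[ n ] e′ → play rs (n ▷ qs) (Within (n ▷ qs ▷ rs) R₂) e′) →
  play (qs ++ rs) n (Within (n ▷ (qs ++ rs)) (λ e′ → e ⊑[ n ] e′ × R₁ e′ × R₂ e′)) e
play-within qs rs {n} w₁ w₂ rewrite ▷-++ n qs rs =
  play-bind qs w₁ λ e′ le r₁ → play-map rs
    (λ e″ le′ r₂ e‴ le″ →
      let le₁ = ⊑-trans le′ (⊑-weaken (▷-increasing (n ▷ qs) rs) le″) in
      ⊑-trans le (⊑-weaken (▷-increasing n qs) le₁) , r₁ e‴ le₁ , r₂ e‴ le″)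
    (w₂ e′ le)

-- Linear temporal logic on a single trace.

module Translation
  (em : ExcludedMiddle (lsuc 0ℓ))
  (AP 𝒱 : Set) (_≟ᴬ_ : DecidableEquality AP) (_≟ⱽ_ : DecidableEquality 𝒱)
  where

  open Logic AP 𝒱 _≟ᴬ_ _≟ⱽ_

  decide : (P : Set) → Dec P
  decide P = map′ lower lift (em {Lift (lsuc 0ℓ) P})

  -- An intermediate logic in which uniform propositions are read from an environment instead of the
  -- trace. The encoding can thus be analysed on unchanged traces; the reinterpretations
  -- `T [ p ↦ s ]ᵀ` enter only when formulas are rendered as bodies.
  data LTL : Set where
    uni⁺ uni⁻   : ℕ → LTL
    prop⁺ prop⁻ : AP → LTL
    tt ff       : LTL
    next        : LTL → LTL
    _⟨_⟩_       : LTL → Op → LTL → LTL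

  infix 3 _,_,_⊩_

  _,_,_⊩_ : Env → Trace → ℕ → LTL → Set
  e , t , i ⊩ uni⁺ k      = e k i ≡ true
  e , t , i ⊩ uni⁻ k      = e k i ≡ false
  e , t , i ⊩ prop⁺ a     = t i a ≡ true
  e , t , i ⊩ prop⁻ a     = t i a ≡ false
  e , t , i ⊩ tt          = ⊤
  e , t , i ⊩ ff          = ⊥
  e , t , i ⊩ next χ      = e , t , suc i ⊩ χ
  e , t , i ⊩ α ⟨ o ⟩ β   = ⟦ o ⟧ (λ j → e , t , j ⊩ α) (λ j → e , t , j ⊩ β) i

  infixr 7 _∧ᴸ_
  infixr 6 _∨ᴸ_

  _∧ᴸ_ _∨ᴸ_ : LTL → LTL → LTL
  α ∧ᴸ β = α ⟨ and ⟩ β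
  α ∨ᴸ β = α ⟨ or ⟩ β

  𝐅 𝐆 : LTL → LTL
  𝐅 χ = tt ⟨ until ⟩ χ
  𝐆 χ = χ ⟨ weak ⟩ ff

  module _ {e : Env} {t : Trace} {i : ℕ} {χ : LTL} where

    𝐅⇒ : e , t , i ⊩ 𝐅 χ → ∃[ j ] i ≤ j × (e , t , j ⊩ χ)
    𝐅⇒ (j , i≤j , h , _) = j , i≤j , h

    𝐅⇐ : ∀ {j} → i ≤ j → e , t , j ⊩ χ → e , t , i ⊩ 𝐅 χ
    𝐅⇐ i≤j h = _ , i≤j , h , λ _ _ _ → tt

    𝐆⇒ : e , t , i ⊩ 𝐆 χ → ∀ j → i ≤ j → e , t , j ⊩ χ
    𝐆⇒ h j i≤j with h j i≤j
    ... | inj₁ h′ = h′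

    𝐆⇐ : (∀ j → i ≤ j → e , t , j ⊩ χ) → e , t , i ⊩ 𝐆 χ
    𝐆⇐ h j i≤j = inj₁ (h j i≤j)

  □[_]_ : ℕ → LTL → LTL
  □[ u ] χ = 𝐆 (uni⁻ u ∨ᴸ χ)

  module _ {e : Env} {t : Trace} {i : ℕ} {u : ℕ} {χ : LTL} where

    □⇒ : e , t , i ⊩ □[ u ] χ → ∀ j → i ≤ j → e u j ≡ true → e , t , j ⊩ χ
    □⇒ h j i≤j uj with 𝐆⇒ {χ = uni⁻ u ∨ᴸ χ} h j i≤j
    ... | inj₁ ¬uj = contradiction (trans (sym uj) ¬uj) λ ()
    ... | inj₂ h′  = h′

    □⇐ : (∀ j → i ≤ j → e u j ≡ true → e , t , j ⊩ χ) → e , t , i ⊩ □[ u ] χ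
    □⇐ h = 𝐆⇐ {χ = uni⁻ u ∨ᴸ χ} λ j i≤j → step j i≤j (e u j) refl
      where
      step : ∀ j → i ≤ j → ∀ b → e u j ≡ b → e , t , j ⊩ uni⁻ u ∨ᴸ χ
      step j i≤j true  uj  = inj₂ (h j i≤j uj)
      step j i≤j false ¬uj = inj₁ ¬uj

  -- The empty team.

  onEmpty : TeamLTL → Bool
  onEmpty (pos a)  = true
  onEmpty (neg a)  = true
  onEmpty (φ ∨ ψ)  = onEmpty φ Bool.∧ onEmpty ψ
  onEmpty (φ ∧ ψ)  = constᴼ and (onEmpty φ) (onEmpty ψ)
  onEmpty (φ U ψ)  = constᴼ until (onEmpty φ) (onEmpty ψ)
  onEmpty (φ W ψ)  = constᴼ weak (onEmpty φ) (onEmpty ψ)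
  onEmpty (X φ)    = onEmpty φ
  onEmpty (φ ∨ᴮ ψ) = constᴼ or (onEmpty φ) (onEmpty ψ)
  onEmpty ∼⊥       = false
  onEmpty (A¹ φ)   = true

  -- Without traces no position differs from another, so temporal operators collapse as in `constᴼ`.
  -- Both halves of a split are empty again, which turns `∨` into a conjunction.
  onEmpty⇔ : ∀ φ {T} → ¬ Nonempty T → ∀ i → (⟨ T , i ⟩⊨ φ) ⇔ onEmpty φ ≡ true

  onEmpty-op : ∀ o φ ψ {T} → ¬ Nonempty T → ∀ i →
    ⟦ o ⟧ (λ j → ⟨ T , j ⟩⊨ φ) (λ j → ⟨ T , j ⟩⊨ ψ) i ⇔ constᴼ o (onEmpty φ) (onEmpty ψ) ≡ true

  onEmpty⇔ (pos a)  ∅T i = mk⇔ (λ _ → refl) (λ _ → lift λ t t∈ → contradiction (t , t∈) ∅T)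
  onEmpty⇔ (neg a)  ∅T i = mk⇔ (λ _ → refl) (λ _ → lift λ t t∈ → contradiction (t , t∈) ∅T)
  onEmpty⇔ (φ ∧ ψ)  ∅T i = onEmpty-op and φ ψ ∅T i
  onEmpty⇔ (φ U ψ)  ∅T i = onEmpty-op until φ ψ ∅T i
  onEmpty⇔ (φ W ψ)  ∅T i = onEmpty-op weak φ ψ ∅T i
  onEmpty⇔ (φ ∨ᴮ ψ) ∅T i = onEmpty-op or φ ψ ∅T i
  onEmpty⇔ (X φ)    ∅T i = onEmpty⇔ φ ∅T (suc i)
  onEmpty⇔ ∼⊥       ∅T i = mk⇔ (λ ne → contradiction (lower ne) ∅T) λ ()
  onEmpty⇔ (A¹ φ)   ∅T i = mk⇔ (λ _ → refl) (λ _ t t∈ → contradiction (t , t∈) ∅T)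
  onEmpty⇔ (φ ∨ ψ) {T} ∅T i = mk⇔
    (λ { (T₁ , T₂ , (into , _) , φ₁ , ψ₂) →
         const⇒ and _ _ i ( to (onEmpty⇔ φ {T₁} (λ (t , t∈) → ∅T (t , into (inj₁ t∈))) i) φ₁
                          , to (onEmpty⇔ ψ {T₂} (λ (t , t∈) → ∅T (t , into (inj₂ t∈))) i) ψ₂ ) })
    (λ both → let (φ∅ , ψ∅) = const⇐ and _ _ i both in
      T , T , ∪-idem (member T)
        , from (onEmpty⇔ φ {T} ∅T i) φ∅ , from (onEmpty⇔ ψ {T} ∅T i) ψ∅)

  onEmpty-op o φ ψ {T} ∅T i = mk⇔
    (const⇒ o _ _ i ∘ ⟦ o ⟧-map (λ j _ → to (onEmpty⇔ φ {T} ∅T j)) (λ j _ → to (onEmpty⇔ ψ {T} ∅T j)))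
    (⟦ o ⟧-map (λ j _ → from (onEmpty⇔ φ {T} ∅T j)) (λ j _ → from (onEmpty⇔ ψ {T} ∅T j)) ∘ const⇐ o _ _ i)

  -- Singleton teams and their flattening to LTL.

  ⊨-resp-≐ : ∀ φ {T T′} → member T ≐ member T′ → ∀ {i} → ⟨ T , i ⟩⊨ φ → ⟨ T′ , i ⟩⊨ φ

  ⊨-resp-≐-op : ∀ o φ ψ {T T′} → member T ≐ member T′ → ∀ {i} →
    ⟦ o ⟧ (λ j → ⟨ T , j ⟩⊨ φ) (λ j → ⟨ T , j ⟩⊨ ψ) i →
    ⟦ o ⟧ (λ j → ⟨ T′ , j ⟩⊨ φ) (λ j → ⟨ T′ , j ⟩⊨ ψ) i

  ⊨-resp-≐ (pos a)  (_ , T′⊆T) (lift h) = lift λ t t∈ → h t (T′⊆T t∈)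
  ⊨-resp-≐ (neg a)  (_ , T′⊆T) (lift h) = lift λ t t∈ → h t (T′⊆T t∈)
  ⊨-resp-≐ (φ ∨ ψ)  (T⊆T′ , T′⊆T) (T₁ , T₂ , (⊆T , T⊆) , h₁ , h₂) =
    T₁ , T₂ , ((λ t∈ → T⊆T′ (⊆T t∈)) , (λ t∈ → T⊆ (T′⊆T t∈))) , h₁ , h₂
  ⊨-resp-≐ (φ ∧ ψ)  T≐ h = ⊨-resp-≐-op and φ ψ T≐ h
  ⊨-resp-≐ (φ U ψ)  T≐ h = ⊨-resp-≐-op until φ ψ T≐ h
  ⊨-resp-≐ (φ W ψ)  T≐ h = ⊨-resp-≐-op weak φ ψ T≐ h
  ⊨-resp-≐ (φ ∨ᴮ ψ) T≐ h = ⊨-resp-≐-op or φ ψ T≐ h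
  ⊨-resp-≐ (X φ)    T≐ h = ⊨-resp-≐ φ T≐ h
  ⊨-resp-≐ ∼⊥       (T⊆T′ , _) (lift (t , t∈)) = lift (t , T⊆T′ t∈)
  ⊨-resp-≐ (A¹ φ)   (_ , T′⊆T) h = λ t t∈ → h t (T′⊆T t∈)

  ⊨-resp-≐-op o φ ψ T≐ = ⟦ o ⟧-map (λ _ _ → ⊨-resp-≐ φ T≐) (λ _ _ → ⊨-resp-≐ ψ T≐)

  -- A split of a singleton gives each disjunct the singleton or the empty
  -- team; a and b tell whether the empty team satisfies the disjuncts α, β.
  splitᴸ : Bool → Bool → LTL → LTL → LTL
  splitᴸ true  true  α β = α ∨ᴸ β
  splitᴸ true  false α β = β
  splitᴸ false true  α β = α
  splitᴸ false false α β = α ∧ᴸ β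

  flat : TeamLTL → LTL
  flat (pos a)  = prop⁺ a
  flat (neg a)  = prop⁻ a
  flat (φ ∨ ψ)  = splitᴸ (onEmpty φ) (onEmpty ψ) (flat φ) (flat ψ)
  flat (φ ∧ ψ)  = flat φ ⟨ and ⟩ flat ψ
  flat (φ U ψ)  = flat φ ⟨ until ⟩ flat ψ
  flat (φ W ψ)  = flat φ ⟨ weak ⟩ flat ψ
  flat (X φ)    = next (flat φ)
  flat (φ ∨ᴮ ψ) = flat φ ⟨ or ⟩ flat ψ
  flat ∼⊥       = tt
  flat (A¹ φ)   = flat φ

  splitᴸ⇒ : ∀ {e t i} a b {α β} → e , t , i ⊩ splitᴸ a b α β →
    ((e , t , i ⊩ α) × b ≡ true) ⊎ (a ≡ true × (e , t , i ⊩ β)) ⊎ ((e , t , i ⊩ α) × (e , t , i ⊩ β))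
  splitᴸ⇒ true  true  (inj₁ h) = inj₁ (h , refl)
  splitᴸ⇒ true  true  (inj₂ h) = inj₂ (inj₁ (refl , h))
  splitᴸ⇒ true  false h        = inj₂ (inj₁ (refl , h))
  splitᴸ⇒ false true  h        = inj₁ (h , refl)
  splitᴸ⇒ false false h        = inj₂ (inj₂ h)

  splitᴸ⇐ : ∀ {e t i} a b {α β} →
    ((e , t , i ⊩ α) × b ≡ true) ⊎ (a ≡ true × (e , t , i ⊩ β)) ⊎ ((e , t , i ⊩ α) × (e , t , i ⊩ β)) →
    e , t , i ⊩ splitᴸ a b α β
  splitᴸ⇐ true  true  (inj₁ (h , _))        = inj₁ h
  splitᴸ⇐ true  true  (inj₂ (inj₁ (_ , h))) = inj₂ h
  splitᴸ⇐ true  true  (inj₂ (inj₂ (h , _))) = inj₁ h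
  splitᴸ⇐ true  false (inj₂ (inj₁ (_ , h))) = h
  splitᴸ⇐ true  false (inj₂ (inj₂ (_ , h))) = h
  splitᴸ⇐ false true  (inj₁ (h , _))        = h
  splitᴸ⇐ false true  (inj₂ (inj₂ (h , _))) = h
  splitᴸ⇐ false false (inj₂ (inj₂ h))       = h

  ∅ᵀ : TraceSet
  ∅ᵀ .member _     = ⊥
  ∅ᵀ .respects _ ()

  ∅ᵀ-empty : ¬ Nonempty ∅ᵀ
  ∅ᵀ-empty (_ , ())

  t∈｛t｝ : ∀ t → member ｛ t ｝ t
  t∈｛t｝ t _ _ = refl

  subsingleton : ∀ {S t} → member S ⊆ member ｛ t ｝ → Nonempty S → member S ≐ member ｛ t ｝
  subsingleton {S} S⊆ (x , x∈) =
    S⊆ , λ y≈t → respects S (λ i p → trans (S⊆ x∈ i p) (sym (y≈t i p))) x∈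

  flat⇔ : ∀ φ e t i → (⟨ ｛ t ｝ , i ⟩⊨ φ) ⇔ (e , t , i ⊩ flat φ)

  flat-op : ∀ o φ ψ e t i →
    ⟦ o ⟧ (λ j → ⟨ ｛ t ｝ , j ⟩⊨ φ) (λ j → ⟨ ｛ t ｝ , j ⟩⊨ ψ) i ⇔ (e , t , i ⊩ flat φ ⟨ o ⟩ flat ψ)

  flat⇔ (pos a)  e t i = mk⇔ (λ h → lower h t (t∈｛t｝ t)) (λ h → lift λ u u≈t → trans (u≈t i a) h)
  flat⇔ (neg a)  e t i = mk⇔ (λ h → lower h t (t∈｛t｝ t)) (λ h → lift λ u u≈t → trans (u≈t i a) h)
  flat⇔ (φ ∧ ψ)  e t i = flat-op and φ ψ e t i
  flat⇔ (φ U ψ)  e t i = flat-op until φ ψ e t i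
  flat⇔ (φ W ψ)  e t i = flat-op weak φ ψ e t i
  flat⇔ (φ ∨ᴮ ψ) e t i = flat-op or φ ψ e t i
  flat⇔ (X φ)    e t i = flat⇔ φ e t (suc i)
  flat⇔ ∼⊥       e t i = mk⇔ (λ _ → tt) (λ _ → lift (t , t∈｛t｝ t))
  flat⇔ (A¹ φ)   e t i = mk⇔
    (λ h → to (flat⇔ φ e t i) (h t (t∈｛t｝ t)))
    (λ h u u≈t → ⊨-resp-≐ φ {｛ t ｝} {｛ u ｝}
      ( (λ v≈t j a → trans (v≈t j a) (sym (u≈t j a)))
      , (λ v≈u j a → trans (v≈u j a) (u≈t j a)))
      (from (flat⇔ φ e t i) h))
  flat⇔ (φ ∨ ψ)  e t i = mk⇔ forward (backward ∘ splitᴸ⇒ (onEmpty φ) (onEmpty ψ))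
    where
    part : ∀ χ {S} → member S ⊆ member ｛ t ｝ → ⟨ S , i ⟩⊨ χ →
      (Nonempty S × ⟨ ｛ t ｝ , i ⟩⊨ χ) ⊎ (¬ Nonempty S × onEmpty χ ≡ true)
    part χ {S} S⊆ h with decide (Nonempty S)
    ... | yes ne = inj₁ (ne , ⊨-resp-≐ χ {S} {｛ t ｝} (subsingleton {S} S⊆ ne) h)
    ... | no  ∅S = inj₂ (∅S , to (onEmpty⇔ χ {S} ∅S i) h)

    forward : ⟨ ｛ t ｝ , i ⟩⊨ (φ ∨ ψ) → e , t , i ⊩ flat (φ ∨ ψ)
    forward (T₁ , T₂ , (⊆t , t⊆) , h₁ , h₂)
      with part φ {T₁} (λ u∈ → ⊆t (inj₁ u∈)) h₁ | part ψ {T₂} (λ u∈ → ⊆t (inj₂ u∈)) h₂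
    ... | inj₁ (_ , φt) | inj₁ (_ , ψt) =
      splitᴸ⇐ (onEmpty φ) (onEmpty ψ) (inj₂ (inj₂ (to (flat⇔ φ e t i) φt , to (flat⇔ ψ e t i) ψt)))
    ... | inj₁ (_ , φt) | inj₂ (_ , ψ∅) =
      splitᴸ⇐ (onEmpty φ) (onEmpty ψ) (inj₁ (to (flat⇔ φ e t i) φt , ψ∅))
    ... | inj₂ (_ , φ∅) | inj₁ (_ , ψt) =
      splitᴸ⇐ (onEmpty φ) (onEmpty ψ) (inj₂ (inj₁ (φ∅ , to (flat⇔ ψ e t i) ψt)))
    ... | inj₂ (∅₁ , _) | inj₂ (∅₂ , _) with t⊆ (t∈｛t｝ t)
    ...   | inj₁ t∈ = contradiction (t , t∈) ∅₁
    ...   | inj₂ t∈ = contradiction (t , t∈) ∅₂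

    backward : _ → ⟨ ｛ t ｝ , i ⟩⊨ (φ ∨ ψ)
    backward (inj₁ (φt , ψ∅)) =
      ｛ t ｝ , ∅ᵀ , (Sum.[ id , ⊥-elim ] , inj₁)
      , from (flat⇔ φ e t i) φt , from (onEmpty⇔ ψ {∅ᵀ} ∅ᵀ-empty i) ψ∅
    backward (inj₂ (inj₁ (φ∅ , ψt))) =
      ∅ᵀ , ｛ t ｝ , (Sum.[ ⊥-elim , id ] , inj₂)
      , from (onEmpty⇔ φ {∅ᵀ} ∅ᵀ-empty i) φ∅ , from (flat⇔ ψ e t i) ψt
    backward (inj₂ (inj₂ (φt , ψt))) =
      ｛ t ｝ , ｛ t ｝ , ∪-idem (member ｛ t ｝)
      , from (flat⇔ φ e t i) φt , from (flat⇔ ψ e t i) ψt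

  flat-op o φ ψ e t i = mk⇔
    (⟦ o ⟧-map (λ j _ → to (flat⇔ φ e t j)) (λ j _ → to (flat⇔ ψ e t j)))
    (⟦ o ⟧-map (λ j _ → from (flat⇔ φ e t j)) (λ j _ → from (flat⇔ ψ e t j)))

  props : TeamLTL → List AP
  props (pos a)  = [ a ]
  props (neg a)  = [ a ]
  props (φ ∨ ψ)  = props φ ++ props ψ
  props (φ ∧ ψ)  = props φ ++ props ψ
  props (φ U ψ)  = props φ ++ props ψ
  props (φ W ψ)  = props φ ++ props ψ
  props (X φ)    = props φ
  props (φ ∨ᴮ ψ) = props φ ++ props ψ
  props ∼⊥       = []
  props (A¹ φ)   = props φ

  -- Flat formulas mention no uniform proposition, hence the unrelated environments, and no atom
  -- outside `props φ`. The coding proposition `p` can therefore be overwritten without affecting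
  -- them.
  flat-local : ∀ φ {e e′ t t′} → (∀ {a} → a ∈ props φ → ∀ j → t j a ≡ t′ j a) → ∀ {i} →
    e , t , i ⊩ flat φ → e′ , t′ , i ⊩ flat φ

  flat-local-op : ∀ o φ ψ {e e′ t t′} →
    (∀ {a} → a ∈ props φ ++ props ψ → ∀ j → t j a ≡ t′ j a) → ∀ {i} →
    e , t , i ⊩ flat φ ⟨ o ⟩ flat ψ → e′ , t′ , i ⊩ flat φ ⟨ o ⟩ flat ψ

  flat-local (pos a)  eq {i} h = trans (sym (eq (here refl) i)) h
  flat-local (neg a)  eq {i} h = trans (sym (eq (here refl) i)) h
  flat-local (φ ∨ ψ)  eq h
    with splitᴸ⇒ (onEmpty φ) (onEmpty ψ) h
  ... | inj₁ (hφ , ψ∅)        =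
    splitᴸ⇐ (onEmpty φ) (onEmpty ψ) (inj₁ (flat-local φ (eq ∘ ∈-++⁺ˡ) hφ , ψ∅))
  ... | inj₂ (inj₁ (φ∅ , hψ)) =
    splitᴸ⇐ (onEmpty φ) (onEmpty ψ) (inj₂ (inj₁ (φ∅ , flat-local ψ (eq ∘ ∈-++⁺ʳ (props φ)) hψ)))
  ... | inj₂ (inj₂ (hφ , hψ)) =
    splitᴸ⇐ (onEmpty φ) (onEmpty ψ)
      (inj₂ (inj₂ (flat-local φ (eq ∘ ∈-++⁺ˡ) hφ , flat-local ψ (eq ∘ ∈-++⁺ʳ (props φ)) hψ)))
  flat-local (φ ∧ ψ)  eq h = flat-local-op and φ ψ eq h
  flat-local (φ U ψ)  eq h = flat-local-op until φ ψ eq h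
  flat-local (φ W ψ)  eq h = flat-local-op weak φ ψ eq h
  flat-local (φ ∨ᴮ ψ) eq h = flat-local-op or φ ψ eq h
  flat-local (X φ)    eq h = flat-local φ eq h
  flat-local ∼⊥       eq h = tt
  flat-local (A¹ φ)   eq h = flat-local φ eq h

  flat-local-op o φ ψ eq =
    ⟦ o ⟧-map (λ _ _ → flat-local φ (eq ∘ ∈-++⁺ˡ)) (λ _ _ → flat-local ψ (eq ∘ ∈-++⁺ʳ (props φ)))

  ↦-here : ∀ t {p s} r → (t [ p ↦ s ]) r p ≡ s r
  ↦-here t {p} r rewrite dec-true (p ≟ᴬ p) refl = refl

  ↦-other : ∀ t {p s q} r → q ≢ p → (t [ p ↦ s ]) r q ≡ t r q
  ↦-other t {p} {q = q} r q≢p rewrite dec-false (q ≟ᴬ p) q≢p = refl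

  -- The encoding of a team formula.

  uniforms : TeamLTL → List Bool
  uniforms (pos a)  = []
  uniforms (neg a)  = []
  -- The challenge comes first, so that the label and the two columns may depend on it.
  uniforms (φ ∨ ψ)  = false ∷ true ∷ true ∷ true ∷ uniforms φ ++ uniforms ψ
  uniforms (φ ∧ ψ)  = true ∷ true ∷ uniforms φ ++ uniforms ψ
  uniforms (φ U ψ)  = true ∷ true ∷ uniforms φ ++ uniforms ψ
  uniforms (φ W ψ)  = true ∷ true ∷ uniforms φ ++ uniforms ψ
  uniforms (X φ)    = true ∷ uniforms φ
  uniforms (φ ∨ᴮ ψ) = true ∷ true ∷ uniforms φ ++ uniforms ψ
  uniforms ∼⊥       = []
  uniforms (A¹ φ)   = []

  module Encoding (p : AP) where

    infixr 5 _⟹_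

    -- Bodies have no negation, so `outside` is the negation of `inside` pushed down to the atoms;
    -- this makes `m ⟹ χ` an implication.
    inside outside : ℕ → LTL
    inside  m = 𝐅 (uni⁺ m ∧ᴸ prop⁺ p)
    outside m = 𝐆 (uni⁻ m ∨ᴸ prop⁻ p)

    _⟹_ : ℕ → LTL → LTL
    m ⟹ χ = outside m ∨ᴸ χ

    -- Labels are claims, so only the step from a label to its justification is enforced, and
    -- positions outside `u` stay unconstrained. One direction is enough because every operator in
    -- `Op` is monotone.
    labelled : Op → ℕ → ℕ → LTL
    labelled o n u = □[ u ] (uni⁺ n ⟨ o ⟩ uni⁺ (suc n))

    -- Variables: n holds the challenged position, n + 1 the position of the
    -- disjuncts, n + 2 and n + 3 their teams.
    splitting : ℕ → ℕ → ℕ → LTL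
    splitting n m u =
        (□[ u ] uni⁻ n ∨ᴸ 𝐅 (uni⁺ n ∧ᴸ uni⁺ (1 + n)))
      ∧ᴸ (m ⟹ inside (2 + n) ∨ᴸ inside (3 + n))
      ∧ᴸ (2 + n ⟹ inside m)
      ∧ᴸ (3 + n ⟹ inside m)

    -- A team is named by a variable m, as the set of traces on which p holds
    -- somewhere on m.  The clauses and witnesses of φ for n, m and u express
    -- that the team named by m satisfies φ at all positions in u; they use
    -- the auxiliary variables from n on.
    clause : TeamLTL → ℕ → ℕ → ℕ → LTL
    clause (pos a)  n m u = m ⟹ □[ u ] flat (pos a)
    clause (neg a)  n m u = m ⟹ □[ u ] flat (neg a)
    clause (φ ∨ ψ)  n m u = splitting n m u
      ∧ᴸ clause φ (4 + n) (2 + n) (1 + n) ∧ᴸ clause ψ (4 + n ▷ uniforms φ) (3 + n) (1 + n)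
    clause (φ ∧ ψ)  n m u = labelled and n u
      ∧ᴸ clause φ (2 + n) m n ∧ᴸ clause ψ (2 + n ▷ uniforms φ) m (1 + n)
    clause (φ U ψ)  n m u = labelled until n u
      ∧ᴸ clause φ (2 + n) m n ∧ᴸ clause ψ (2 + n ▷ uniforms φ) m (1 + n)
    clause (φ W ψ)  n m u = labelled weak n u
      ∧ᴸ clause φ (2 + n) m n ∧ᴸ clause ψ (2 + n ▷ uniforms φ) m (1 + n)
    clause (φ ∨ᴮ ψ) n m u = labelled or n u
      ∧ᴸ clause φ (2 + n) m n ∧ᴸ clause ψ (2 + n ▷ uniforms φ) m (1 + n)
    clause (X φ)    n m u = □[ u ] next (uni⁺ n) ∧ᴸ clause φ (1 + n) m n
    clause ∼⊥       n m u = tt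
    clause (A¹ φ)   n m u = m ⟹ □[ u ] flat φ

    witnesses : TeamLTL → ℕ → ℕ → ℕ → List LTL
    witnesses (pos a)  n m u = []
    witnesses (neg a)  n m u = []
    witnesses (φ ∨ ψ)  n m u =
      witnesses φ (4 + n) (2 + n) (1 + n) ++ witnesses ψ (4 + n ▷ uniforms φ) (3 + n) (1 + n)
    witnesses (φ ∧ ψ)  n m u = witnesses φ (2 + n) m n ++ witnesses ψ (2 + n ▷ uniforms φ) m (1 + n)
    witnesses (φ U ψ)  n m u = witnesses φ (2 + n) m n ++ witnesses ψ (2 + n ▷ uniforms φ) m (1 + n)
    witnesses (φ W ψ)  n m u = witnesses φ (2 + n) m n ++ witnesses ψ (2 + n ▷ uniforms φ) m (1 + n)
    witnesses (φ ∨ᴮ ψ) n m u = witnesses φ (2 + n) m n ++ witnesses ψ (2 + n ▷ uniforms φ) m (1 + n)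
    witnesses (X φ)    n m u = witnesses φ (1 + n) m n
    witnesses ∼⊥       n m u = [ □[ u ] ff ∨ᴸ inside m ]
    witnesses (A¹ φ)   n m u = []

    ∼⊥-free⇒no-witnesses : ∀ φ → ∼⊥-Free φ → ∀ n m u → witnesses φ n m u ≡ []
    ∼⊥-free⇒no-witnesses (pos a)  _         n m u = refl
    ∼⊥-free⇒no-witnesses (neg a)  _         n m u = refl
    ∼⊥-free⇒no-witnesses (φ ∨ ψ)  (hφ , hψ) n m u =
      cong₂ _++_ (∼⊥-free⇒no-witnesses φ hφ _ _ _) (∼⊥-free⇒no-witnesses ψ hψ _ _ _)
    ∼⊥-free⇒no-witnesses (φ ∧ ψ)  (hφ , hψ) n m u =
      cong₂ _++_ (∼⊥-free⇒no-witnesses φ hφ _ _ _) (∼⊥-free⇒no-witnesses ψ hψ _ _ _)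
    ∼⊥-free⇒no-witnesses (φ U ψ)  (hφ , hψ) n m u =
      cong₂ _++_ (∼⊥-free⇒no-witnesses φ hφ _ _ _) (∼⊥-free⇒no-witnesses ψ hψ _ _ _)
    ∼⊥-free⇒no-witnesses (φ W ψ)  (hφ , hψ) n m u =
      cong₂ _++_ (∼⊥-free⇒no-witnesses φ hφ _ _ _) (∼⊥-free⇒no-witnesses ψ hψ _ _ _)
    ∼⊥-free⇒no-witnesses (X φ)    hφ        n m u = ∼⊥-free⇒no-witnesses φ hφ _ _ _
    ∼⊥-free⇒no-witnesses (φ ∨ᴮ ψ) (hφ , hψ) n m u =
      cong₂ _++_ (∼⊥-free⇒no-witnesses φ hφ _ _ _) (∼⊥-free⇒no-witnesses ψ hψ _ _ _)
    ∼⊥-free⇒no-witnesses (A¹ φ)   _         n m u = refl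

    -- Outside `A¹`, the only atom that fails on the empty team is `∼⊥`, and each such occurrence
    -- demands a witness. This settles the case in which no trace is left to carry the clauses.
    no-witnesses⇒onEmpty : ∀ φ n m u → witnesses φ n m u ≡ [] → onEmpty φ ≡ true

    no-witnesses⇒onEmpty-node : ∀ φ ψ n₁ m₁ u₁ n₂ m₂ u₂ →
      witnesses φ n₁ m₁ u₁ ++ witnesses ψ n₂ m₂ u₂ ≡ [] →
      ∀ o → constᴼ o (onEmpty φ) (onEmpty ψ) ≡ true
    no-witnesses⇒onEmpty-node φ ψ n₁ m₁ u₁ n₂ m₂ u₂ eq o
      rewrite no-witnesses⇒onEmpty φ n₁ m₁ u₁ (++-conicalˡ _ _ eq)
            | no-witnesses⇒onEmpty ψ n₂ m₂ u₂ (++-conicalʳ (witnesses φ n₁ m₁ u₁) _ eq) =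
      all-true o
      where
      all-true : ∀ o → constᴼ o true true ≡ true
      all-true and   = refl
      all-true or    = refl
      all-true until = refl
      all-true weak  = refl

    no-witnesses⇒onEmpty (pos a)  n m u eq = refl
    no-witnesses⇒onEmpty (neg a)  n m u eq = refl
    no-witnesses⇒onEmpty (φ ∨ ψ)  n m u eq = no-witnesses⇒onEmpty-node φ ψ _ _ _ _ _ _ eq and
    no-witnesses⇒onEmpty (φ ∧ ψ)  n m u eq = no-witnesses⇒onEmpty-node φ ψ _ _ _ _ _ _ eq and
    no-witnesses⇒onEmpty (φ U ψ)  n m u eq = no-witnesses⇒onEmpty-node φ ψ _ _ _ _ _ _ eq until
    no-witnesses⇒onEmpty (φ W ψ)  n m u eq = no-witnesses⇒onEmpty-node φ ψ _ _ _ _ _ _ eq weak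
    no-witnesses⇒onEmpty (X φ)    n m u eq = no-witnesses⇒onEmpty φ _ _ _ eq
    no-witnesses⇒onEmpty (φ ∨ᴮ ψ) n m u eq = no-witnesses⇒onEmpty-node φ ψ _ _ _ _ _ _ eq or
    no-witnesses⇒onEmpty (A¹ φ)   n m u eq = refl

    -- `B` is a bare predicate because completeness evaluates on the exact encodings `Encoded F`,
    -- which need not be closed under `≈`.
    module Evaluation (i : ℕ) (B : Trace → Set) where

      Inside : (ℕ → Bool) → Trace → Set
      Inside s t = ∃[ r ] i ≤ r × s r ≡ true × t r p ≡ true

      module _ {e : Env} {t : Trace} (m : ℕ) where

        inside⇒ : e , t , i ⊩ inside m → Inside (e m) t
        inside⇒ = 𝐅⇒ {e} {t} {χ = uni⁺ m ∧ᴸ prop⁺ p}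

        inside⇐ : Inside (e m) t → e , t , i ⊩ inside m
        inside⇐ (r , i≤r , h) = 𝐅⇐ {e} {t} {χ = uni⁺ m ∧ᴸ prop⁺ p} i≤r h

        ⟹⇒ : ∀ χ → e , t , i ⊩ m ⟹ χ → Inside (e m) t → e , t , i ⊩ χ
        ⟹⇒ χ (inj₂ h) _ = h
        ⟹⇒ χ (inj₁ out) (r , i≤r , mr , pr) with 𝐆⇒ {e} {t} {χ = uni⁻ m ∨ᴸ prop⁻ p} out r i≤r
        ... | inj₁ ¬mr = contradiction (trans (sym mr) ¬mr) λ ()
        ... | inj₂ ¬pr = contradiction (trans (sym pr) ¬pr) λ ()

        ⟹⇐ : ∀ χ → (Inside (e m) t → e , t , i ⊩ χ) → e , t , i ⊩ m ⟹ χ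
        ⟹⇐ χ h with decide (Inside (e m) t)
        ... | yes ins = inj₂ (h ins)
        ... | no ¬ins = inj₁ (𝐆⇐ {e} {t} {χ = uni⁻ m ∨ᴸ prop⁻ p} λ r i≤r → out r i≤r (e m r) (t r p) refl refl)
          where
          out : ∀ r → i ≤ r → ∀ b c → e m r ≡ b → t r p ≡ c → e , t , r ⊩ uni⁻ m ∨ᴸ prop⁻ p
          out r i≤r false c     ¬mr _   = inj₁ ¬mr
          out r i≤r true  false _   ¬pr = inj₂ ¬pr
          out r i≤r true  true  mr  pr  = contradiction (r , i≤r , mr , pr) ¬ins

      Everywhere Somewhere : Env → LTL → Set
      Everywhere e χ = ∀ t → B t → e , t , i ⊩ χ
      Somewhere  e χ = ∃[ t ] B t × (e , t , i ⊩ χ)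

      -- Guarded by satisfiability: even at an empty label a witness must be some trace of `B`.
      Good : LTL → List LTL → Env → Set
      Good χ ws e = Everywhere e χ × (Satisfiable B → All (Somewhere e) ws)

      Wins : TeamLTL → ℕ → ℕ → ℕ → Env → Set
      Wins φ n m u = Good (clause φ n m u) (witnesses φ n m u)

    -- Soundness: from a won game to team satisfaction.

    module Soundness
      (i : ℕ) (T T′ : TraceSet)
      (forth : ∀ t → member T t → ∃[ t′ ] member T′ t′ × t ≈[ p ] t′)
      (back  : ∀ t′ → member T′ t′ → ∃[ t ] member T t × t ≈[ p ] t′)
      (nonempty : Nonempty T′)
      where

      open Evaluation i (member T′)

      -- Variants of one trace in `T′` may disagree on `p`; a single variant inside `s` puts the
      -- trace into the team. This is safe, since clauses hold on all of `T′` and flat formulas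
      -- without `p` cannot tell such variants apart.
      Team : (ℕ → Bool) → TraceSet
      Team s .member t = member T t × ∃[ t′ ] member T′ t′ × t ≈[ p ] t′ × Inside s t′
      Team s .respects e (t∈ , t′ , t′∈ , t≈t′ , ins) =
        respects T e t∈ , t′ , t′∈ , (λ i q q≢p → trans (sym (e i q)) (t≈t′ i q q≢p)) , ins

      Sound : TeamLTL → Set₁
      Sound φ = ∀ n m u e → m < n → u < n →
        play (uniforms φ) n (Above (n ▷ uniforms φ) (Wins φ n m u)) e →
        ∀ j → i ≤ j → e u j ≡ true → ⟨ Team (e m) , j ⟩⊨ φ

      sound-flat : ∀ φ {n m u e} → m < n → u < n → p ∉ props φ →
        Above n (Good (m ⟹ □[ u ] flat φ) []) e →
        ∀ j → i ≤ j → e u j ≡ true → ∀ t → member (Team (e m)) t → e , t , j ⊩ flat φ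
      sound-flat φ {m = m} {u} m< u< p∉ (e′ , le , every , _) j i≤j uj t (_ , t′ , t′∈ , t≈t′ , ins) =
        flat-local φ (λ {a} a∈ k → sym (t≈t′ k a λ { refl → p∉ a∈ }))
          (□⇒ {e′} {t′} {χ = flat φ}
            (⟹⇒ {e′} {t′} m (□[ u ] flat φ) (every t′ t′∈) (subst (λ s → Inside s t′) (le .agree m<) ins))
            j i≤j (trans (cong (λ s → s j) (sym (le .agree u<))) uj))

      sound-pair : ∀ φ ψ → Sound φ → Sound ψ → ∀ {n m₁ u₁ m₂ u₂ χ e} →
        m₁ < n → u₁ < n → m₂ < n → u₂ < n →
        play (uniforms φ ++ uniforms ψ) n
          (Above (n ▷ (uniforms φ ++ uniforms ψ))
            (Good (χ ∧ᴸ clause φ n m₁ u₁ ∧ᴸ clause ψ (n ▷ uniforms φ) m₂ u₂)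
                  (witnesses φ n m₁ u₁ ++ witnesses ψ (n ▷ uniforms φ) m₂ u₂))) e →
        (∃[ e′ ] e ⊑[ n ] e′ × Everywhere e′ χ)
        × (∀ j → i ≤ j → e u₁ j ≡ true → ⟨ Team (e m₁) , j ⟩⊨ φ)
        × (∀ j → i ≤ j → e u₂ j ≡ true → ⟨ Team (e m₂) , j ⟩⊨ ψ)
      sound-pair φ ψ soundφ soundψ {n} {m₁} {u₁} {m₂} {u₂} {χ} {e} m₁< u₁< m₂< u₂< w =
        local (play-outcome (uniforms φ ++ uniforms ψ) w) ,
        soundφ n m₁ u₁ e m₁< u₁<
          (play-map (uniforms φ)
            (λ { _ _ (e″ , le , every , some) →
                 e″ , le , (λ t t∈ → proj₁ (proj₂ (every t t∈))) , ++⁻ˡ _ ∘ some })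
            (play-aboveˡ (uniforms φ) (uniforms ψ) w)) ,
        right (play-aboveʳ (uniforms φ) (uniforms ψ) w)
        where
        n≤ : n ≤ n ▷ uniforms φ
        n≤ = ▷-increasing n (uniforms φ)

        local : _ → ∃[ e′ ] e ⊑[ n ] e′ × Everywhere e′ χ
        local (e′ , le , e″ , le′ , every , _) =
          e″ , ⊑-trans le (⊑-weaken (▷-increasing n (uniforms φ ++ uniforms ψ)) le′) ,
          λ t t∈ → proj₁ (every t t∈)

        right : _ → ∀ j → i ≤ j → e u₂ j ≡ true → ⟨ Team (e m₂) , j ⟩⊨ ψ
        right (e′ , le , w′) j i≤j uj =
          subst (λ s → ⟨ Team s , j ⟩⊨ ψ) (sym (le .agree m₂<))
            (soundψ (n ▷ uniforms φ) m₂ u₂ e′ (<-≤-trans m₂< n≤) (<-≤-trans u₂< n≤)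
              (play-map (uniforms ψ)
                (λ { _ _ (e″ , le , every , some) →
                     e″ , le , (λ t t∈ → proj₂ (proj₂ (every t t∈)))
                     , ++⁻ʳ (witnesses φ n m₁ u₁) ∘ some })
                w′)
              j i≤j (trans (cong (λ s → s j) (sym (le .agree u₂<))) uj))

      sound-op : ∀ o φ ψ → Sound φ → Sound ψ → ∀ n m u e → m < n → u < n →
        play (true ∷ true ∷ uniforms φ ++ uniforms ψ) n
          (Above (2 + n ▷ (uniforms φ ++ uniforms ψ))
            (Good (labelled o n u ∧ᴸ clause φ (2 + n) m n ∧ᴸ clause ψ (2 + n ▷ uniforms φ) m (1 + n))
                  (witnesses φ (2 + n) m n ++ witnesses ψ (2 + n ▷ uniforms φ) m (1 + n)))) e →
        ∀ j → i ≤ j → e u j ≡ true →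
        ⟦ o ⟧ (λ k → ⟨ Team (e m) , k ⟩⊨ φ) (λ k → ⟨ Team (e m) , k ⟩⊨ ψ) j
      sound-op o φ ψ soundφ soundψ n m u e m< u< (s₁ , s₂ , w) j i≤j uj
        with sound-pair φ ψ soundφ soundψ {χ = labelled o n u}
               (m<n⇒m<1+n (m<n⇒m<1+n m<)) (m<n⇒m<1+n (n<1+n n)) (m<n⇒m<1+n (m<n⇒m<1+n m<)) (n<1+n (suc n)) w
      ... | (e′ , le , every) , hφ , hψ =
        ⟦ o ⟧-map
          (λ k j≤k h → subst (λ s → ⟨ Team s , k ⟩⊨ φ) (sym (old .agree m<))
            (hφ k (≤-trans i≤j j≤k) (trans (cong (λ s → s k) (le .agree (m<n⇒m<1+n (n<1+n n)))) h)))
          (λ k j≤k h → subst (λ s → ⟨ Team s , k ⟩⊨ ψ) (sym (old .agree m<))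
            (hψ k (≤-trans i≤j j≤k) (trans (cong (λ s → s k) (le .agree (n<1+n (suc n)))) h)))
          -- The condition on labels does not depend on the trace but is asserted only along traces
          -- of `T′`, so some trace has to be produced.
          (□⇒ {e′} {proj₁ nonempty} {χ = uni⁺ n ⟨ o ⟩ uni⁺ (suc n)} (every _ (proj₂ nonempty)) j i≤j
            (trans (cong (λ s → s j) (sym (⊑-step (⊑-step le) .agree u<))) uj))
        where
        old : e ⊑[ n ] e [ n ≔ s₁ ] [ suc n ≔ s₂ ]
        old = ⊑-step (⊑-step ⊑-refl)

      -- Challenging with the single position `j` isolates one split: as `j` lies in `u`, the reply
      -- cannot claim that the challenge missed `u`, so its label contains `j`. Both disjuncts then
      -- hold at `j` for the two teams named in the reply, and the three implications make these a
      -- split of the given team.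
      sound-∨ : ∀ φ ψ → Sound φ → Sound ψ → Sound (φ ∨ ψ)
      sound-∨ φ ψ soundφ soundψ n m u e m< u< w j i≤j uj = conclude (w v)
        where
        v : ℕ → Bool
        v k = does (k ≟ j)

        v⇒≡ : ∀ k → v k ≡ true → k ≡ j
        v⇒≡ k = does⇒ (k ≟ j)

        conclude : _ → ⟨ Team (e m) , j ⟩⊨ (φ ∨ ψ)
        conclude (s₁ , s₂ , s₃ , w′)
          with sound-pair φ ψ soundφ soundψ {χ = splitting n m u}
                 (m<n⇒m<1+n (n<1+n (2 + n))) (m<n⇒m<1+n (m<n⇒m<1+n (n<1+n (1 + n))))
                 (n<1+n (3 + n)) (m<n⇒m<1+n (m<n⇒m<1+n (n<1+n (1 + n)))) w′
        ... | (e′ , le , every) , hφ , hψ =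
          Team (e₄ (2 + n)) , Team (e₄ (3 + n)) , (union⊆ , ⊆union) , hφ j i≤j target , hψ j i≤j target
          where
          e₄ : Env
          e₄ = e [ n ≔ v ] [ 1 + n ≔ s₁ ] [ 2 + n ≔ s₂ ] [ 3 + n ≔ s₃ ]

          old : e ⊑[ n ] e′
          old = ⊑-step (⊑-step (⊑-step (⊑-step le)))

          v≡ : v ≡ e′ n
          v≡ = trans (sym (≔-here e n)) (⊑-step (⊑-step (⊑-step le)) .agree (n<1+n n))

          l≡ : e₄ (2 + n) ≡ e′ (2 + n)
          l≡ = le .agree (m<n⇒m<1+n (n<1+n (2 + n)))

          r≡ : e₄ (3 + n) ≡ e′ (3 + n)
          r≡ = le .agree (n<1+n (3 + n))

          target : e₄ (1 + n) j ≡ true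
          target with proj₁ (every _ (proj₂ nonempty))
          ... | inj₁ h = contradiction
            (trans (sym (dec-true (j ≟ j) refl))
              (trans (cong (λ s → s j) v≡)
                (□⇒ {e′} {proj₁ nonempty} {χ = uni⁻ n} h j i≤j (trans (cong (λ s → s j) (sym (old .agree u<))) uj))))
            λ ()
          ... | inj₂ h with 𝐅⇒ {e′} {proj₁ nonempty} {χ = uni⁺ n ∧ᴸ uni⁺ (1 + n)} h
          ...   | k , _ , nk , 1+nk with v⇒≡ k (trans (cong (λ s → s k) v≡) nk)
          ...     | refl = trans (cong (λ s → s k) (le .agree (m<n⇒m<1+n (m<n⇒m<1+n (n<1+n (1 + n)))))) 1+nk

          union⊆ : member (Team (e₄ (2 + n))) ∪ member (Team (e₄ (3 + n))) ⊆ member (Team (e m))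
          union⊆ (inj₁ (t∈ , t′ , t′∈ , t≈t′ , ins)) with every t′ t′∈
          ... | _ , _ , l⟹m , _ = t∈ , t′ , t′∈ , t≈t′ ,
            subst (λ s → Inside s t′) (sym (old .agree m<))
              (inside⇒ {e′} {t′} m (⟹⇒ {e′} {t′} (2 + n) (inside m) l⟹m (subst (λ s → Inside s t′) l≡ ins)))
          union⊆ (inj₂ (t∈ , t′ , t′∈ , t≈t′ , ins)) with every t′ t′∈
          ... | _ , _ , _ , r⟹m = t∈ , t′ , t′∈ , t≈t′ ,
            subst (λ s → Inside s t′) (sym (old .agree m<))
              (inside⇒ {e′} {t′} m (⟹⇒ {e′} {t′} (3 + n) (inside m) r⟹m (subst (λ s → Inside s t′) r≡ ins)))

          ⊆union : member (Team (e m)) ⊆ member (Team (e₄ (2 + n))) ∪ member (Team (e₄ (3 + n)))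
          ⊆union (t∈ , t′ , t′∈ , t≈t′ , ins) with every t′ t′∈
          ... | _ , m⟹ , _ with ⟹⇒ {e′} {t′} m (inside (2 + n) ∨ᴸ inside (3 + n)) m⟹
                                    (subst (λ s → Inside s t′) (old .agree m<) ins)
          ...   | inj₁ l = inj₁ (t∈ , t′ , t′∈ , t≈t′ ,
            subst (λ s → Inside s t′) (sym l≡) (inside⇒ {e′} {t′} (2 + n) l))
          ...   | inj₂ r = inj₂ (t∈ , t′ , t′∈ , t≈t′ ,
            subst (λ s → Inside s t′) (sym r≡) (inside⇒ {e′} {t′} (3 + n) r))

      sound-X : ∀ φ → Sound φ → Sound (X φ)
      sound-X φ soundφ n m u e m< u< (s , w) j i≤j uj
        with play-outcome (uniforms φ) w
      ... | _ , le , e′ , le′ , every , _ =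
        subst (λ s → ⟨ Team s , suc j ⟩⊨ φ) (sym (⊑-≔ {e = e} .agree m<))
          (soundφ (1 + n) m n (e [ n ≔ s ]) (m<n⇒m<1+n m<) (n<1+n n)
            (play-map (uniforms φ)
              (λ { _ _ (e″ , le″ , every , some) → e″ , le″ , (λ t t∈ → proj₂ (every t t∈)) , some }) w)
            (suc j) (m≤n⇒m≤1+n i≤j)
            (trans (cong (λ s → s (suc j)) (le″ .agree (n<1+n n)))
              (□⇒ {e′} {proj₁ nonempty} {χ = next (uni⁺ n)} (proj₁ (every _ (proj₂ nonempty))) j i≤j
                (trans (cong (λ s → s j) (sym (⊑-step le″ .agree u<))) uj))))
        where
        le″ : e [ n ≔ s ] ⊑[ suc n ] e′
        le″ = ⊑-trans le (⊑-weaken (▷-increasing (suc n) (uniforms φ)) le′)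

      sound-∼⊥ : Sound ∼⊥
      sound-∼⊥ n m u e m< u< (e′ , le , _ , some) j i≤j uj with some nonempty
      ... | (t′ , t′∈ , inj₁ h) ∷ [] =
        contradiction (trans (cong (λ s → s j) (sym (le .agree u<))) uj)
          (□⇒ {e′} {t′} {χ = ff} h j i≤j)
      ... | (t′ , t′∈ , inj₂ h) ∷ [] with back t′ t′∈
      ...   | t , t∈ , t≈t′ = lift (t , t∈ , t′ , t′∈ , t≈t′ ,
        subst (λ s → Inside s t′) (sym (le .agree m<)) (inside⇒ {e′} {t′} m h))

      sound : ∀ φ → p ∉ props φ → Sound φ
      sound (pos a) p∉ n m u e m< u< w j i≤j uj = lift (sound-flat (pos a) m< u< p∉ w j i≤j uj)
      sound (neg a) p∉ n m u e m< u< w j i≤j uj = lift (sound-flat (neg a) m< u< p∉ w j i≤j uj)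
      sound (A¹ φ)  p∉ n m u e m< u< w j i≤j uj t t∈ =
        from (flat⇔ φ e t j) (sound-flat φ m< u< p∉ w j i≤j uj t t∈)
      sound (φ ∨ ψ)  p∉ = sound-∨ φ ψ (sound φ (p∉ ∘ ∈-++⁺ˡ)) (sound ψ (p∉ ∘ ∈-++⁺ʳ (props φ)))
      sound (φ ∧ ψ)  p∉ = sound-op and φ ψ (sound φ (p∉ ∘ ∈-++⁺ˡ)) (sound ψ (p∉ ∘ ∈-++⁺ʳ (props φ)))
      sound (φ U ψ)  p∉ = sound-op until φ ψ (sound φ (p∉ ∘ ∈-++⁺ˡ)) (sound ψ (p∉ ∘ ∈-++⁺ʳ (props φ)))
      sound (φ W ψ)  p∉ = sound-op weak φ ψ (sound φ (p∉ ∘ ∈-++⁺ˡ)) (sound ψ (p∉ ∘ ∈-++⁺ʳ (props φ)))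
      sound (φ ∨ᴮ ψ) p∉ = sound-op or φ ψ (sound φ (p∉ ∘ ∈-++⁺ˡ)) (sound ψ (p∉ ∘ ∈-++⁺ʳ (props φ)))
      sound (X φ)    p∉ = sound-X φ (sound φ p∉)
      sound ∼⊥       p∉ = sound-∼⊥

    -- Completeness: from team satisfaction to a winning strategy.

    module Completeness (i : ℕ) (T : TraceSet) where

      -- Position i + b of p stores membership in the b-th team of the family F.
      stored : (ℕ → TraceSet) → Trace → ℕ → Bool
      stored F t r = does (decide (member (F (r ∸ i)) t))

      encode : (ℕ → TraceSet) → Trace → Trace
      encode F t = t [ p ↦ stored F t ]

      Encoded : (ℕ → TraceSet) → Trace → Set
      Encoded F t′ = ∃[ t ] member T t × t′ ≡ encode F t

      module Strategy (F : ℕ → TraceSet) where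

        open Evaluation i (Encoded F)

        Represents : (ℕ → Bool) → TraceSet → Set
        Represents s S = ∀ t → member T t → Inside s (encode F t) ⇔ member S t

        -- Formulas evaluated at `i` look at no earlier position, so the stored family has to start
        -- there; hence the offset.
        column : ℕ → ℕ → Bool
        column b r = does (r ≟ i + b)

        column-represents : ∀ {S} b → F b ≡ S → Represents (column b) S
        column-represents b refl t t∈ = mk⇔ into outof
          where
          into : Inside (column b) (encode F t) → member (F b) t
          into (r , _ , sr , pr) with does⇒ (r ≟ i + b) sr
          ... | refl = subst (λ c → member (F c) t) (m+n∸m≡n i b)
            (does⇒ (decide _) (trans (sym (↦-here t {p} {stored F t} r)) pr))

          outof : member (F b) t → Inside (column b) (encode F t)
          outof t∈F = i + b , m≤m+n i b , dec-true (i + b ≟ i + b) refl ,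
            trans (↦-here t {p} {stored F t} (i + b))
              (dec-true (decide _) (subst (λ c → member (F c) t) (sym (m+n∸m≡n i b)) t∈F))

        Winning : TeamLTL → TraceSet → Set₁
        Winning φ S = ∀ n m u e → m < n → u < n → Represents (e m) S →
          (∀ j → i ≤ j → e u j ≡ true → ⟨ S , j ⟩⊨ φ) →
          play (uniforms φ) n (Within (n ▷ uniforms φ) (Wins φ n m u)) e

        win-flat : ∀ φ {S n m u e} → m < n → u < n → p ∉ props φ → Represents (e m) S →
          (∀ j → i ≤ j → e u j ≡ true → ∀ t → member S t → e , t , j ⊩ flat φ) →
          Within n (Good (m ⟹ □[ u ] flat φ) []) e
        win-flat φ {m = m} {u} m< u< p∉ rep h e′ le =
          (λ { _ (t , t∈ , refl) → ⟹⇐ {e′} {encode F t} m (□[ u ] flat φ) λ ins →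
               □⇐ {e′} {encode F t} {χ = flat φ} λ j i≤j uj →
                 flat-local φ (λ {a} a∈ k → sym (↦-other t {p} {stored F t} k λ { refl → p∉ a∈ }))
                   (h j i≤j (trans (cong (λ s → s j) (le .agree u<)) uj) t
                     (to (rep t t∈) (subst (λ s → Inside s (encode F t)) (sym (le .agree m<)) ins))) })
          , λ _ → []

        win-pair : ∀ φ ψ {S₁ S₂} → Winning φ S₁ → Winning ψ S₂ → ∀ {n m₁ u₁ m₂ u₂ χ e} →
          m₁ < n → u₁ < n → m₂ < n → u₂ < n →
          Represents (e m₁) S₁ → Represents (e m₂) S₂ →
          (∀ j → i ≤ j → e u₁ j ≡ true → ⟨ S₁ , j ⟩⊨ φ) →
          (∀ j → i ≤ j → e u₂ j ≡ true → ⟨ S₂ , j ⟩⊨ ψ) →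
          (∀ e′ → e ⊑[ n ] e′ → Everywhere e′ χ) →
          play (uniforms φ ++ uniforms ψ) n
            (Within (n ▷ (uniforms φ ++ uniforms ψ))
              (Good (χ ∧ᴸ clause φ n m₁ u₁ ∧ᴸ clause ψ (n ▷ uniforms φ) m₂ u₂)
                    (witnesses φ n m₁ u₁ ++ witnesses ψ (n ▷ uniforms φ) m₂ u₂))) e
        win-pair φ ψ {S₂ = S₂} winφ winψ {n} {m₁} {u₁} {m₂} {u₂} {e = e} m₁< u₁< m₂< u₂< rep₁ rep₂ h₁ h₂ local =
          play-map (uniforms φ ++ uniforms ψ)
            {P = Within (n ▷ (uniforms φ ++ uniforms ψ)) (λ e′ →
              e ⊑[ n ] e′ × Wins φ n m₁ u₁ e′ × Wins ψ (n ▷ uniforms φ) m₂ u₂ e′)}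
            (λ _ _ r e′ le → let (old , (every₁ , some₁) , (every₂ , some₂)) = r e′ le in
              (λ t t∈ → local e′ old t t∈ , every₁ t t∈ , every₂ t t∈) ,
              (λ ne → ++⁺ (some₁ ne) (some₂ ne)))
            (play-within (uniforms φ) (uniforms ψ)
              (winφ n m₁ u₁ e m₁< u₁< rep₁ h₁)
              (λ e′ le → winψ (n ▷ uniforms φ) m₂ u₂ e′ (<-≤-trans m₂< n≤) (<-≤-trans u₂< n≤)
                (subst (λ s → Represents s S₂) (le .agree m₂<) rep₂)
                (λ j i≤j uj → h₂ j i≤j (trans (cong (λ s → s j) (le .agree u₂<)) uj))))
          where
          n≤ : n ≤ n ▷ uniforms φ
          n≤ = ▷-increasing n (uniforms φ)

        win-op : ∀ o φ ψ {S} → Winning φ S → Winning ψ S → ∀ n m u e → m < n → u < n →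
          Represents (e m) S →
          (∀ j → i ≤ j → e u j ≡ true → ⟦ o ⟧ (λ k → ⟨ S , k ⟩⊨ φ) (λ k → ⟨ S , k ⟩⊨ ψ) j) →
          play (true ∷ true ∷ uniforms φ ++ uniforms ψ) n
            (Within (2 + n ▷ (uniforms φ ++ uniforms ψ))
              (Good (labelled o n u ∧ᴸ clause φ (2 + n) m n ∧ᴸ clause ψ (2 + n ▷ uniforms φ) m (1 + n))
                    (witnesses φ (2 + n) m n ++ witnesses ψ (2 + n ▷ uniforms φ) m (1 + n)))) e
        win-op o φ ψ {S} winφ winψ n m u e m< u< rep h =
          -- The labels are the full truth sets on `S`, the largest correct choice, so an operator
          -- that holds on `S` also holds on them.
          truth φ , truth ψ ,
          win-pair φ ψ winφ winψ {χ = labelled o n u}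
            (m<n⇒m<1+n (m<n⇒m<1+n m<)) (m<n⇒m<1+n (n<1+n n)) (m<n⇒m<1+n (m<n⇒m<1+n m<)) (n<1+n (suc n))
            rep₂ rep₂
            (λ j i≤j uj → does⇒ em (trans (cong (λ s → s j) φ≡) uj))
            (λ j i≤j uj → does⇒ em (trans (cong (λ s → s j) ψ≡) uj))
            (λ e′ le t _ → □⇐ {e′} {t} {χ = uni⁺ n ⟨ o ⟩ uni⁺ (suc n)} λ j i≤j uj →
              ⟦ o ⟧-map
                (λ k _ hφ → trans (cong (λ s → s k) (sym (trans φ≡ (le .agree (m<n⇒m<1+n (n<1+n n))))))
                              (dec-true em hφ))
                (λ k _ hψ → trans (cong (λ s → s k) (sym (trans ψ≡ (le .agree (n<1+n (suc n))))))
                              (dec-true em hψ))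
                (h j i≤j (trans (cong (λ s → s j) (⊑-step (⊑-step le) .agree u<)) uj)))
          where
          truth : TeamLTL → ℕ → Bool
          truth χ j = does (em {⟨ S , j ⟩⊨ χ})

          e₂ : Env
          e₂ = e [ n ≔ truth φ ] [ suc n ≔ truth ψ ]

          rep₂ : Represents (e₂ m) S
          rep₂ = subst (λ s → Represents s S) (⊑-step (⊑-step (⊑-refl {e = e₂})) .agree m<) rep

          φ≡ : truth φ ≡ e₂ n
          φ≡ = trans (sym (≔-here e n)) (⊑-≔ {e = e [ n ≔ truth φ ]} .agree (n<1+n n))

          ψ≡ : truth ψ ≡ e₂ (suc n)
          ψ≡ = sym (≔-here (e [ n ≔ truth φ ]) (suc n))

        win-X : ∀ φ {S} → Winning φ S → Winning (X φ) S
        win-X φ {S} winφ n m u e m< u< rep h =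
          s , play-map (uniforms φ) {P = Within (1 + n ▷ uniforms φ) (Wins φ (1 + n) m n)}
            (λ e₂ le₂ r e′ le → let (every , some) = r e′ le in
              (λ t t∈ → □⇐ {e′} {t} {χ = next (uni⁺ n)} (λ j i≤j uj → local e′
                  (⊑-trans le₂ (⊑-weaken (▷-increasing (1 + n) (uniforms φ)) le)) j i≤j uj)
                , every t t∈)
              , some)
            (winφ (1 + n) m n (e [ n ≔ s ]) (m<n⇒m<1+n m<) (n<1+n n)
              (subst (λ s → Represents s S) (⊑-≔ {e = e} .agree m<) rep)
              (λ j i≤j sj → does⇒ em (trans (cong (λ s → s j) (sym (≔-here e n))) sj)))
          where
          s : ℕ → Bool
          s j = does (em {⟨ S , j ⟩⊨ φ})

          local : ∀ e′ → e [ n ≔ s ] ⊑[ 1 + n ] e′ → ∀ j → i ≤ j → e′ u j ≡ true → e′ n (suc j) ≡ true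
          local e′ le j i≤j uj = trans
            (cong (λ s → s (suc j)) (sym (trans (sym (≔-here e n)) (le .agree (n<1+n n)))))
            (dec-true em (h j i≤j (trans (cong (λ s → s j) (⊑-step le .agree u<)) uj)))

        -- If `u` labels no position from `i` on, any encoded trace serves as witness. Otherwise `S`
        -- is nonempty, and its inclusion in `T` places the encoding of one of its traces among the
        -- candidates.
        win-∼⊥ : ∀ {S} → member S ⊆ member T → Winning ∼⊥ S
        win-∼⊥ {S} S⊆T n m u e m< u< rep h e′ le = (λ _ _ → tt) , λ { (t , t∈) → some t t∈ (decide _) ∷ [] }
          where
          some : ∀ t → Encoded F t → Dec (∃[ j ] i ≤ j × e u j ≡ true) →
            Somewhere e′ (□[ u ] ff ∨ᴸ inside m)
          some t t∈ (no  ¬u) = t , t∈ , inj₁ (□⇐ {e′} {t} {χ = ff} λ j i≤j uj →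
            ¬u (j , i≤j , trans (cong (λ s → s j) (le .agree u<)) uj))
          some _ _  (yes (j , i≤j , uj)) with h j i≤j uj
          ... | lift (t , t∈S) = encode F t , (t , S⊆T t∈S , refl) , inj₂ (inside⇐ {e′} {encode F t} m
            (subst (λ s → Inside s (encode F t)) (le .agree m<) (from (rep t (S⊆T t∈S)) t∈S)))

        -- A split for every position `j` is stored before the challenge `v` is known. The reply
        -- takes some `j` in both `u` and `v`, labels `j` alone, and points to the two columns of
        -- the split at `j`.
        win-∨ : ∀ φ ψ {S} (S₁ S₂ : ℕ → TraceSet) →
          (∀ j → ∃[ b ] F b ≡ S₁ j) → (∀ j → ∃[ b ] F b ≡ S₂ j) →
          (∀ j → member (S₁ j) ∪ member (S₂ j) ≐ member S) →
          (∀ j → ⟨ S , j ⟩⊨ (φ ∨ ψ) → (⟨ S₁ j , j ⟩⊨ φ) × (⟨ S₂ j , j ⟩⊨ ψ)) →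
          (∀ j → Winning φ (S₁ j)) → (∀ j → Winning ψ (S₂ j)) → Winning (φ ∨ ψ) S
        win-∨ φ ψ {S} S₁ S₂ stored₁ stored₂ union split win₁ win₂ n m u e m< u< rep h v =
          reply (decide (∃[ j ] i ≤ j × e u j ≡ true × v j ≡ true))
          where
          Reply : Set
          Reply = play (true ∷ true ∷ true ∷ uniforms φ ++ uniforms ψ) (1 + n)
            (Within (4 + n ▷ (uniforms φ ++ uniforms ψ)) (Wins (φ ∨ ψ) n m u)) (e [ n ≔ v ])

          answer : ∀ j (w : ℕ → Bool) →
            (∀ k → i ≤ k → w k ≡ true → (⟨ S₁ j , k ⟩⊨ φ) × (⟨ S₂ j , k ⟩⊨ ψ)) →
            (∀ k → i ≤ k → e u k ≡ true → v k ≡ false) ⊎ (∃[ k ] i ≤ k × v k ≡ true × w k ≡ true) →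
            Reply
          answer j w hw met =
            w , column l , column r ,
            win-pair φ ψ (win₁ j) (win₂ j) {χ = splitting n m u}
              (m<n⇒m<1+n (n<1+n (2 + n))) (m<n⇒m<1+n (m<n⇒m<1+n (n<1+n (1 + n))))
              (n<1+n (3 + n)) (m<n⇒m<1+n (m<n⇒m<1+n (n<1+n (1 + n))))
              (subst (λ s → Represents s (S₁ j)) l≡ (column-represents l (proj₂ (stored₁ j))))
              (subst (λ s → Represents s (S₂ j)) r≡ (column-represents r (proj₂ (stored₂ j))))
              (λ k i≤k wk → proj₁ (hw k i≤k (trans (cong (λ s → s k) w≡) wk)))
              (λ k i≤k wk → proj₂ (hw k i≤k (trans (cong (λ s → s k) w≡) wk)))
              local
            where
            l r : ℕ
            l = proj₁ (stored₁ j)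
            r = proj₁ (stored₂ j)

            e₁ e₂ e₃ e₄ : Env
            e₁ = e [ n ≔ v ]
            e₂ = e₁ [ 1 + n ≔ w ]
            e₃ = e₂ [ 2 + n ≔ column l ]
            e₄ = e₃ [ 3 + n ≔ column r ]

            v≡ : v ≡ e₄ n
            v≡ = trans (sym (≔-here e n))
              (⊑-step (⊑-step (⊑-step (⊑-refl {e = e₄}))) .agree (n<1+n n))

            w≡ : w ≡ e₄ (1 + n)
            w≡ = trans (sym (≔-here e₁ (1 + n)))
              (⊑-step (⊑-step (⊑-refl {e = e₄})) .agree (n<1+n (1 + n)))

            l≡ : column l ≡ e₄ (2 + n)
            l≡ = trans (sym (≔-here e₂ (2 + n))) (⊑-step (⊑-refl {e = e₄}) .agree (n<1+n (2 + n)))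

            r≡ : column r ≡ e₄ (3 + n)
            r≡ = sym (≔-here e₃ (3 + n))

            local : ∀ e′ → e₄ ⊑[ 4 + n ] e′ → Everywhere e′ (splitting n m u)
            local e′ le _ (t , t∈ , refl) = challenge met ,
              ⟹⇐ {e′} {encode F t} m (inside (2 + n) ∨ᴸ inside (3 + n)) cover ,
              ⟹⇐ {e′} {encode F t} (2 + n) (inside m) (λ ins → inside⇐ {e′} {encode F t} m
                (from (repₘ t t∈) (proj₁ (union j) (inj₁ (to (repₗ t t∈) ins))))) ,
              ⟹⇐ {e′} {encode F t} (3 + n) (inside m) (λ ins → inside⇐ {e′} {encode F t} m
                (from (repₘ t t∈) (proj₁ (union j) (inj₂ (to (repᵣ t t∈) ins)))))
              where
              old : e ⊑[ n ] e′
              old = ⊑-step (⊑-step (⊑-step (⊑-step le)))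

              repₘ : Represents (e′ m) S
              repₘ = subst (λ s → Represents s S) (old .agree m<) rep

              repₗ : Represents (e′ (2 + n)) (S₁ j)
              repₗ = subst (λ s → Represents s (S₁ j))
                (trans l≡ (le .agree (m<n⇒m<1+n (n<1+n (2 + n))))) (column-represents l (proj₂ (stored₁ j)))

              repᵣ : Represents (e′ (3 + n)) (S₂ j)
              repᵣ = subst (λ s → Represents s (S₂ j))
                (trans r≡ (le .agree (n<1+n (3 + n)))) (column-represents r (proj₂ (stored₂ j)))

              cover : Inside (e′ m) (encode F t) →
                e′ , encode F t , i ⊩ inside (2 + n) ∨ᴸ inside (3 + n)
              cover ins with proj₂ (union j) (to (repₘ t t∈) ins)
              ... | inj₁ t∈₁ = inj₁ (inside⇐ {e′} {encode F t} (2 + n) (from (repₗ t t∈) t∈₁))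
              ... | inj₂ t∈₂ = inj₂ (inside⇐ {e′} {encode F t} (3 + n) (from (repᵣ t t∈) t∈₂))

              challenge : _ →
                e′ , encode F t , i ⊩ □[ u ] uni⁻ n ∨ᴸ 𝐅 (uni⁺ n ∧ᴸ uni⁺ (1 + n))
              challenge (inj₁ ¬uv) = inj₁ (□⇐ {e′} {encode F t} {χ = uni⁻ n} λ k i≤k uk →
                trans (cong (λ s → s k) (sym v≡′)) (¬uv k i≤k (trans (cong (λ s → s k) (old .agree u<)) uk)))
                where
                v≡′ : v ≡ e′ n
                v≡′ = trans v≡ (le .agree (m<n⇒m<1+n (m<n⇒m<1+n (m<n⇒m<1+n (n<1+n n)))))
              challenge (inj₂ (k , i≤k , vk , wk)) =
                inj₂ (𝐅⇐ {e′} {encode F t} {χ = uni⁺ n ∧ᴸ uni⁺ (1 + n)} i≤k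
                  ( trans (cong (λ s → s k)
                      (sym (trans v≡ (le .agree (m<n⇒m<1+n (m<n⇒m<1+n (m<n⇒m<1+n (n<1+n n)))))))) vk
                  , trans (cong (λ s → s k)
                      (sym (trans w≡ (le .agree (m<n⇒m<1+n (m<n⇒m<1+n (n<1+n (1 + n)))))))) wk))

          reply : Dec (∃[ j ] i ≤ j × e u j ≡ true × v j ≡ true) → Reply
          reply (yes (j , i≤j , uj , vj)) = answer j (λ k → does (k ≟ j))
            (λ k _ kj → subst (λ k → (⟨ S₁ j , k ⟩⊨ φ) × (⟨ S₂ j , k ⟩⊨ ψ))
                          (sym (does⇒ (k ≟ j) kj)) (split j (h j i≤j uj)))
            (inj₂ (j , i≤j , vj , dec-true (j ≟ j) refl))
          -- No labelled position is challenged, so the empty label is a legal reply. The columns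
          -- must still cover `S`, for which the split at 0 is as good as any.
          reply (no ¬uv) = answer 0 (const false) (λ _ _ ())
            (inj₁ λ k i≤k uk → ¬-not λ vk → ¬uv (k , i≤k , uk , vk))

      open Strategy using (Winning; win-flat; win-op; win-X; win-∼⊥; win-∨)

      -- `G` lists the teams that the strategy must find stored. Since every family covering `G`
      -- will do, the demands of subformulas can be merged afterwards into the one family that `p`
      -- stores.
      Strategic : TeamLTL → TraceSet → Set₁
      Strategic φ S = Σ[ G ∈ (ℕ → TraceSet) ] (∀ F → F Covers G → Winning F φ S)

      strategic-both : ∀ {φ ψ χ S} →
        (∀ F → Winning F φ S → Winning F ψ S → Winning F χ S) →
        Strategic φ S → Strategic ψ S → Strategic χ S
      strategic-both win (G₁ , win₁) (G₂ , win₂) = G₁ ⊕ G₂ , λ F cov →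
        win F (win₁ F (covers-⊕ˡ G₁ G₂ cov)) (win₂ F (covers-⊕ʳ G₁ G₂ cov))

      record Split (φ ψ : TeamLTL) (S : TraceSet) (j : ℕ) : Set₁ where
        field
          S₁ S₂ : TraceSet
          union : member S₁ ∪ member S₂ ≐ member S
          holds : ⟨ S , j ⟩⊨ (φ ∨ ψ) → (⟨ S₁ , j ⟩⊨ φ) × (⟨ S₂ , j ⟩⊨ ψ)

      split-at : ∀ φ ψ S j → Split φ ψ S j
      split-at φ ψ S j with em {⟨ S , j ⟩⊨ (φ ∨ ψ)}
      ... | yes (S₁ , S₂ , union , h) = record { S₁ = S₁ ; S₂ = S₂ ; union = union ; holds = λ _ → h }
      -- Where no split satisfies the disjuncts, the trivial one keeps `union` valid at every
      -- position; the reply to a challenge that misses the label relies on it.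
      ... | no ¬h = record { S₁ = S ; S₂ = S ; union = ∪-idem (member S) ; holds = λ h → contradiction h ¬h }

      strategic : ∀ φ → p ∉ props φ → ∀ S → member S ⊆ member T → Strategic φ S
      -- A leaf splits nothing; `const T` merely fills the family.
      strategic (pos a)  p∉ S S⊆T = const T , λ F _ n m u e m< u< rep h →
        win-flat F (pos a) {S} m< u< p∉ rep λ j i≤j uj → lower (h j i≤j uj)
      strategic (neg a)  p∉ S S⊆T = const T , λ F _ n m u e m< u< rep h →
        win-flat F (neg a) {S} m< u< p∉ rep λ j i≤j uj → lower (h j i≤j uj)
      strategic (A¹ φ)   p∉ S S⊆T = const T , λ F _ n m u e m< u< rep h →
        win-flat F φ {S} m< u< p∉ rep λ j i≤j uj t t∈ → to (flat⇔ φ e t j) (h j i≤j uj t t∈)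
      strategic ∼⊥       p∉ S S⊆T = const T , λ F _ → win-∼⊥ F {S} S⊆T
      strategic (X φ)    p∉ S S⊆T with strategic φ p∉ S S⊆T
      ... | G , win = G , λ F cov → win-X F φ {S} (win F cov)
      strategic (φ ∧ ψ)  p∉ S S⊆T = strategic-both {φ} {ψ} {φ ∧ ψ} {S} (λ F → win-op F and φ ψ {S})
        (strategic φ (p∉ ∘ ∈-++⁺ˡ) S S⊆T) (strategic ψ (p∉ ∘ ∈-++⁺ʳ (props φ)) S S⊆T)
      strategic (φ U ψ)  p∉ S S⊆T = strategic-both {φ} {ψ} {φ U ψ} {S} (λ F → win-op F until φ ψ {S})
        (strategic φ (p∉ ∘ ∈-++⁺ˡ) S S⊆T) (strategic ψ (p∉ ∘ ∈-++⁺ʳ (props φ)) S S⊆T)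
      strategic (φ W ψ)  p∉ S S⊆T = strategic-both {φ} {ψ} {φ W ψ} {S} (λ F → win-op F weak φ ψ {S})
        (strategic φ (p∉ ∘ ∈-++⁺ˡ) S S⊆T) (strategic ψ (p∉ ∘ ∈-++⁺ʳ (props φ)) S S⊆T)
      strategic (φ ∨ᴮ ψ) p∉ S S⊆T = strategic-both {φ} {ψ} {φ ∨ᴮ ψ} {S} (λ F → win-op F or φ ψ {S})
        (strategic φ (p∉ ∘ ∈-++⁺ˡ) S S⊆T) (strategic ψ (p∉ ∘ ∈-++⁺ʳ (props φ)) S S⊆T)
      strategic (φ ∨ ψ)  p∉ S S⊆T = ⨁ G , λ F cov → win-∨ F φ ψ {S} S₁ S₂
          (λ j → covers-⨁ G cov j 0) (λ j → covers-⨁ G cov j 1) union holds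
          -- Entries 0 and 1 of `G j` are the halves of the split at `j`, hence the shift by 2 to
          -- the demands of the subformulas.
          (λ j → proj₂ (left j) F (covers-⊕ˡ (proj₁ (left j)) _ (λ b → covers-⨁ G cov j (2 + b))))
          (λ j → proj₂ (right j) F (covers-⊕ʳ (proj₁ (left j)) _ (λ b → covers-⨁ G cov j (2 + b))))
        where
        open module Splits j = Split (split-at φ ψ S j)

        left : ∀ j → Strategic φ (S₁ j)
        left j = strategic φ (p∉ ∘ ∈-++⁺ˡ) (S₁ j) (λ t∈ → S⊆T (proj₁ (union j) (inj₁ t∈)))

        right : ∀ j → Strategic ψ (S₂ j)
        right j = strategic ψ (p∉ ∘ ∈-++⁺ʳ (props φ)) (S₂ j) (λ t∈ → S⊆T (proj₁ (union j) (inj₂ t∈)))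

        G : ℕ → ℕ → TraceSet
        G j = S₁ j ◂ S₂ j ◂ (proj₁ (left j) ⊕ proj₁ (right j))

  -- Rendering LTL as bodies.

  bin : Op → Body → Body → Body
  bin and   = _∧_
  bin or    = _∨_
  bin until = _U_
  bin weak  = _W_

  bin⇔ : ∀ o {Π α β} {P Q : ℕ → Set} →
    (∀ j → (⟨ Π , j ⟩⊨ᴮ α) ⇔ P j) → (∀ j → (⟨ Π , j ⟩⊨ᴮ β) ⇔ Q j) →
    ∀ j → (⟨ Π , j ⟩⊨ᴮ bin o α β) ⇔ ⟦ o ⟧ P Q j
  bin⇔ o {Π} {α} {β} hα hβ j = mk⇔
    (⟦ o ⟧-map (λ k _ → to (hα k)) (λ k _ → to (hβ k)) ∘ unfold o)
    (fold o ∘ ⟦ o ⟧-map (λ k _ → from (hα k)) (λ k _ → from (hβ k)))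
    where
    unfold : ∀ o → ⟨ Π , j ⟩⊨ᴮ bin o α β → ⟦ o ⟧ (λ k → ⟨ Π , k ⟩⊨ᴮ α) (λ k → ⟨ Π , k ⟩⊨ᴮ β) j
    unfold and   h = h
    unfold or    h = h
    unfold until h = h
    unfold weak  h = h

    fold : ∀ o → ⟦ o ⟧ (λ k → ⟨ Π , k ⟩⊨ᴮ α) (λ k → ⟨ Π , k ⟩⊨ᴮ β) j → ⟨ Π , j ⟩⊨ᴮ bin o α β
    fold and   h = h
    fold or    h = h
    fold until h = h
    fold weak  h = h

  :=-here : ∀ Π {π t} → (Π [ π := t ]) π ≡ just t
  :=-here Π {π} rewrite dec-true (π ≟ⱽ π) refl = refl

  :=-other : ∀ Π {π t π′} → π′ ≢ π → (Π [ π := t ]) π′ ≡ Π π′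
  :=-other Π {π} {π′ = π′} π′≢π rewrite dec-false (π′ ≟ⱽ π) π′≢π = refl

  module Naming
    (p : AP) (f : ℕ → AP) (g : ℕ → 𝒱)
    (f-distinct : ∀ {m n} → m < n → f m ≢ f n) (g-distinct : ∀ {m n} → m < n → g m ≢ g n)
    where

    open Encoding p

    at : 𝒱 → LTL → Body
    at π (uni⁺ k)    = pos (f k) π
    at π (uni⁻ k)    = neg (f k) π
    at π (prop⁺ a)   = pos a π
    at π (prop⁻ a)   = neg a π
    -- Bodies have no constants; `p` on the bound trace and its complement stand in for them.
    at π tt          = pos p π ∨ neg p π
    at π ff          = pos p π ∧ neg p π
    at π (next χ)    = X (at π χ)
    at π (α ⟨ o ⟩ β) = bin o (at π α) (at π β)

    WellNamed : ℕ → LTL → Set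
    WellNamed N (uni⁺ k)    = k < N
    WellNamed N (uni⁻ k)    = k < N
    WellNamed N (prop⁺ a)   = ∀ k → a ≢ f k
    WellNamed N (prop⁻ a)   = ∀ k → a ≢ f k
    WellNamed N tt          = ⊤
    WellNamed N ff          = ⊤
    WellNamed N (next χ)    = WellNamed N χ
    WellNamed N (α ⟨ o ⟩ β) = WellNamed N α × WellNamed N β

    -- `t′` is `t` after the first `N` uniform quantifiers. Names `f k` with `N ≤ k` are left open,
    -- as they are yet to be overwritten.
    record Overlay (N : ℕ) (e : Env) (t t′ : Trace) : Set where
      field
        new : ∀ {k} r → k < N → t′ r (f k) ≡ e k r
        old : ∀ {a} r → (∀ k → a ≢ f k) → t′ r a ≡ t r a
    open Overlay

    any-just⇔ : ∀ {Π : Assignment} {π t} {P : Trace → Set} → Π π ≡ just t → MaybeAny.Any P (Π π) ⇔ P t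
    any-just⇔ eq rewrite eq = mk⇔ MaybeAny.drop-just just

    ≡-resp⇔ : ∀ {b c d : Bool} → b ≡ c → (b ≡ d) ⇔ (c ≡ d)
    ≡-resp⇔ refl = mk⇔ id id

    at⇔ : ∀ {N e t t′ Π π} → Overlay N e t t′ → Π π ≡ just t′ → ∀ χ → WellNamed N χ →
      ∀ j → (⟨ Π , j ⟩⊨ᴮ at π χ) ⇔ (e , t , j ⊩ χ)
    at⇔ {Π = Π} ov eq (uni⁺ k)  k<N j =
      mk⇔ (to (≡-resp⇔ (ov .new j k<N)) ∘ to (any-just⇔ {Π} eq)) (from (any-just⇔ {Π} eq) ∘ from (≡-resp⇔ (ov .new j k<N)))
    at⇔ {Π = Π} ov eq (uni⁻ k)  k<N j =
      mk⇔ (to (≡-resp⇔ (ov .new j k<N)) ∘ to (any-just⇔ {Π} eq)) (from (any-just⇔ {Π} eq) ∘ from (≡-resp⇔ (ov .new j k<N)))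
    at⇔ {Π = Π} ov eq (prop⁺ a) a≢  j =
      mk⇔ (to (≡-resp⇔ (ov .old j a≢)) ∘ to (any-just⇔ {Π} eq)) (from (any-just⇔ {Π} eq) ∘ from (≡-resp⇔ (ov .old j a≢)))
    at⇔ {Π = Π} ov eq (prop⁻ a) a≢  j =
      mk⇔ (to (≡-resp⇔ (ov .old j a≢)) ∘ to (any-just⇔ {Π} eq)) (from (any-just⇔ {Π} eq) ∘ from (≡-resp⇔ (ov .old j a≢)))
    at⇔ {t′ = t′} {Π} ov eq tt _ j = mk⇔ (λ _ → tt) (λ _ → either (t′ j p) refl)
      where
      either : ∀ b → t′ j p ≡ b → _
      either true  h = inj₁ (from (any-just⇔ {Π} eq) h)
      either false h = inj₂ (from (any-just⇔ {Π} eq) h)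
    at⇔ {Π = Π} ov eq ff _ j = mk⇔
      (λ (h , h′) → contradiction (trans (sym (to (any-just⇔ {Π} eq) h)) (to (any-just⇔ {Π} eq) h′)) λ ())
      (λ ())
    at⇔ ov eq (next χ)    wn        j = at⇔ ov eq χ wn (suc j)
    at⇔ ov eq (α ⟨ o ⟩ β) (wα , wβ) j = bin⇔ o (at⇔ ov eq α wα) (at⇔ ov eq β wβ) j

    quantify : List Bool → ℕ → HyperQPTL⁺ → HyperQPTL⁺
    quantify []           n h = h
    quantify (true ∷ qs)  n h = ∃ᵘp · f n ∙ quantify qs (suc n) h
    quantify (false ∷ qs) n h = ∀ᵘp · f n ∙ quantify qs (suc n) h

    record Overlays (N : ℕ) (e : Env) (B : Trace → Set) (T : TraceSet) : Set where
      field
        forth : ∀ t → B t → ∃[ t′ ] member T t′ × Overlay N e t t′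
        back  : ∀ t′ → member T t′ → ∃[ t ] B t × Overlay N e t t′
    open Overlays

    overlay-step : ∀ {n e t t′ t″ s} → Overlay n e t t′ → t″ ≈ t′ [ f n ↦ s ] →
      Overlay (suc n) (e [ n ≔ s ]) t t″
    overlay-step {n} {e} {t′ = t′} {s = s} ov eq .new {k} r k<1+n with m<1+n⇒m<n∨m≡n k<1+n
    ... | inj₁ k<n  = trans (eq r (f k)) (trans (↦-other t′ {f n} {s} r (f-distinct k<n))
      (trans (ov .new r k<n) (cong (λ s → s r) (≔-other {e} (<⇒≢ k<n)))))
    ... | inj₂ refl = trans (eq r (f k)) (trans (↦-here t′ {f k} {s} r) (cong (λ s → s r) (sym (≔-here e k))))
    overlay-step {n} {t′ = t′} {s = s} ov eq .old {a} r a≢ =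
      trans (eq r a) (trans (↦-other t′ {f n} {s} r (a≢ n)) (ov .old r a≢))

    overlays-step : ∀ {n e B T} s → Overlays n e B T → Overlays (suc n) (e [ n ≔ s ]) B (T [ f n ↦ s ]ᵀ)
    overlays-step s ovs .forth t t∈ with ovs .forth t t∈
    ... | t′ , t′∈ , ov = _ , (t′ , t′∈ , λ _ _ → refl) , overlay-step ov (λ _ _ → refl)
    overlays-step s ovs .back t″ (t′ , t′∈ , eq) with ovs .back t′ t′∈
    ... | t , t∈ , ov = t , t∈ , overlay-step ov eq

    -- Each choice of `s` extends the environment and the overlay together. The premise ranges over
    -- all `Π′` because uniform quantifiers reinterpret the assignment too.
    quantify⇔ : ∀ qs {n e B T Π i h} {P : Env → Set} →
      (∀ {e′ T′ Π′} → Overlays (n ▷ qs) e′ B T′ → (⟨ Π′ , i ⟩⊨[ T′ ] h) ⇔ P e′) →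
      Overlays n e B T → (⟨ Π , i ⟩⊨[ T ] quantify qs n h) ⇔ play qs n P e
    quantify⇔ []           h⇔ ovs = h⇔ ovs
    quantify⇔ (true ∷ qs)  h⇔ ovs = mk⇔
      (λ (s , h) → s , to (quantify⇔ qs h⇔ (overlays-step s ovs)) h)
      (λ (s , w) → s , from (quantify⇔ qs h⇔ (overlays-step s ovs)) w)
    quantify⇔ (false ∷ qs) h⇔ ovs = mk⇔
      (λ h s → to (quantify⇔ qs h⇔ (overlays-step s ovs)) (h s))
      (λ w s → from (quantify⇔ qs h⇔ (overlays-step s ovs)) (w s))

    -- The block of trace quantifiers.

    close : ℕ → List LTL → Body → HyperQPTL⁺
    close k []       b = ∀π · g k ∙ body b
    close k (w ∷ ws) b = ∃π · g k ∙ close (suc k) ws b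

    matrix : ℕ → List LTL → LTL → Body
    matrix k []       χ = at (g k) χ
    matrix k (w ∷ ws) χ = at (g k) w ∧ matrix (suc k) ws χ

    Agree : ℕ → Assignment → Assignment → Set
    Agree k Π Π′ = ∀ {l} → l < k → Π′ (g l) ≡ Π (g l)

    agree-:= : ∀ {k t} Π → Agree k Π (Π [ g k := t ])
    agree-:= Π l<k = :=-other Π (g-distinct l<k)

    agree-step : ∀ {k t Π Π′} → Agree (suc k) (Π [ g k := t ]) Π′ → Agree k Π Π′
    agree-step {Π = Π} ag l<k = trans (ag (m<n⇒m<1+n l<k)) (agree-:= Π l<k)

    -- The conjunct of an existential variable sits beneath the final `∀π`; one instance of that
    -- quantifier suffices to read it off, and nonemptiness provides it.
    close-outcome : ∀ {T i} ws {k Π b} → Nonempty T → ⟨ Π , i ⟩⊨[ T ] close k ws b →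
      ∃[ Π′ ] Agree k Π Π′ × (⟨ Π′ , i ⟩⊨ᴮ b)
    close-outcome []       {Π = Π} (t , t∈) h = _ , agree-:= Π , lower (h t t∈)
    close-outcome (w ∷ ws) {Π = Π} ne (t , _ , h) with close-outcome ws ne h
    ... | Π′ , ag , h′ = Π′ , agree-step {t = t} {Π} {Π′} ag , h′

    module _ {N : ℕ} {e : Env} {T : TraceSet} {i : ℕ} {χ : LTL} {B : Trace → Set}
      (ovs : Overlays N e B T) (wχ : WellNamed N χ)
      where

      open Evaluation i B

      -- The body `b` stays whole while `ws` is consumed, so the induction assumes that `b` implies
      -- the remaining matrix under every assignment that keeps the variables bound so far. The
      -- trace chosen for `∃π` itself shows that `close-outcome` applies.
      close⇒ : ∀ ws {k Π b} → All (WellNamed N) ws →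
        (∀ Π′ → Agree k Π Π′ → ⟨ Π′ , i ⟩⊨ᴮ b → ⟨ Π′ , i ⟩⊨ᴮ matrix k ws χ) →
        ⟨ Π , i ⟩⊨[ T ] close k ws b → Everywhere e χ × All (Somewhere e) ws
      close⇒ [] {Π = Π} _ implied h = (λ t t∈ → everywhere t (ovs .forth t t∈)) , []
        where
        everywhere : ∀ t → ∃[ t′ ] member T t′ × Overlay N e t t′ → e , t , i ⊩ χ
        everywhere t (t′ , t′∈ , ov) =
          to (at⇔ {Π = Π [ _ := t′ ]} ov (:=-here Π) χ wχ i) (implied _ (agree-:= Π) (lower (h t′ t′∈)))
      close⇒ (w ∷ ws) {k} {Π} (ww ∷ wws) implied (t′ , t′∈ , h)
        with close⇒ ws wws (λ Π′ ag hb → proj₂ (implied Π′ (agree-step {t = t′} {Π} {Π′} ag) hb)) h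
           | close-outcome ws (t′ , t′∈) h | ovs .back t′ t′∈
      ... | every , some | Π′ , ag , hb | t , t∈ , ov =
        every ,
        (t , t∈ , to (at⇔ {Π = Π′} ov (trans (ag (n<1+n k)) (:=-here Π)) w ww i)
          (proj₁ (implied Π′ (agree-step {t = t′} {Π} {Π′} ag) hb)))
        ∷ some

      close⇐ : ∀ ws {k Π b} → All (WellNamed N) ws →
        (∀ Π′ → Agree k Π Π′ → ⟨ Π′ , i ⟩⊨ᴮ matrix k ws χ → ⟨ Π′ , i ⟩⊨ᴮ b) →
        Everywhere e χ → All (Somewhere e) ws → ⟨ Π , i ⟩⊨[ T ] close k ws b
      close⇐ [] {Π = Π} _ implies every _ t′ t′∈ with ovs .back t′ t′∈
      ... | t , t∈ , ov =
        lift (implies _ (agree-:= Π) (from (at⇔ {Π = Π [ _ := t′ ]} ov (:=-here Π) χ wχ i) (every t t∈)))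
      close⇐ (w ∷ ws) {k} {Π} (ww ∷ wws) implies every ((t , t∈ , hw) ∷ some) with ovs .forth t t∈
      ... | t′ , t′∈ , ov = t′ , t′∈ , close⇐ ws wws
        (λ Π′ ag h → implies Π′ (agree-step {t = t′} {Π} {Π′} ag)
          (from (at⇔ {Π = Π′} ov (trans (ag (n<1+n k)) (:=-here Π)) w ww i) hw , h))
        every some

      close⇔ : ∀ ws {Π} → All (WellNamed N) ws →
        (⟨ Π , i ⟩⊨[ T ] close 0 ws (matrix 0 ws χ)) ⇔ (Everywhere e χ × All (Somewhere e) ws)
      close⇔ ws wws = mk⇔ (close⇒ ws wws (λ _ _ h → h))
        (λ (every , some) → close⇐ ws wws (λ _ _ h → h) every some)

    -- Well-named encodings.

    flat-wellNamed : ∀ {N} φ → (∀ {a} → a ∈ props φ → ∀ k → a ≢ f k) → WellNamed N (flat φ)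

    flat-wellNamed-both : ∀ {N} φ ψ → (∀ {a} → a ∈ props φ ++ props ψ → ∀ k → a ≢ f k) →
      WellNamed N (flat φ) × WellNamed N (flat ψ)
    flat-wellNamed-both φ ψ new =
      flat-wellNamed φ (new ∘ ∈-++⁺ˡ) , flat-wellNamed ψ (new ∘ ∈-++⁺ʳ (props φ))

    flat-wellNamed (pos a)  new = new (here refl)
    flat-wellNamed (neg a)  new = new (here refl)
    flat-wellNamed (φ ∨ ψ)  new with onEmpty φ | onEmpty ψ
    ... | true  | true  = flat-wellNamed-both φ ψ new
    ... | true  | false = proj₂ (flat-wellNamed-both φ ψ new)
    ... | false | true  = proj₁ (flat-wellNamed-both φ ψ new)
    ... | false | false = flat-wellNamed-both φ ψ new
    flat-wellNamed (φ ∧ ψ)  new = flat-wellNamed-both φ ψ new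
    flat-wellNamed (φ U ψ)  new = flat-wellNamed-both φ ψ new
    flat-wellNamed (φ W ψ)  new = flat-wellNamed-both φ ψ new
    flat-wellNamed (φ ∨ᴮ ψ) new = flat-wellNamed-both φ ψ new
    flat-wellNamed (X φ)    new = flat-wellNamed φ new
    flat-wellNamed ∼⊥       new = tt
    flat-wellNamed (A¹ φ)   new = flat-wellNamed φ new

    module _ {N : ℕ} (p-new : ∀ k → p ≢ f k) where

      AllWellNamed : TeamLTL → Set
      AllWellNamed φ = ∀ n {m u} → m < n → u < n → n ▷ uniforms φ ≤ N →
        WellNamed N (clause φ n m u) × All (WellNamed N) (witnesses φ n m u)

      inside-wellNamed : ∀ {m} → m < N → WellNamed N (inside m)
      inside-wellNamed m< = tt , m< , p-new

      ⟹-wellNamed : ∀ {m χ} → m < N → WellNamed N χ → WellNamed N (m ⟹ χ)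
      ⟹-wellNamed m< wχ = ((m< , p-new) , tt) , wχ

      ▷-bounds : ∀ n qs rs → n ▷ (qs ++ rs) ≤ N → (n ▷ qs ≤ N) × (n ▷ qs ▷ rs ≤ N)
      ▷-bounds n qs rs le =
        ≤-trans (▷-increasing (n ▷ qs) rs) (≤-trans (≤-reflexive (sym (▷-++ n qs rs))) le) ,
        ≤-trans (≤-reflexive (sym (▷-++ n qs rs))) le

      wellNamed-pair : ∀ φ ψ → AllWellNamed φ → AllWellNamed ψ → ∀ {n m₁ u₁ m₂ u₂ χ} →
        m₁ < n → u₁ < n → m₂ < n → u₂ < n → n ▷ (uniforms φ ++ uniforms ψ) ≤ N → WellNamed N χ →
        WellNamed N (χ ∧ᴸ clause φ n m₁ u₁ ∧ᴸ clause ψ (n ▷ uniforms φ) m₂ u₂)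
        × All (WellNamed N) (witnesses φ n m₁ u₁ ++ witnesses ψ (n ▷ uniforms φ) m₂ u₂)
      wellNamed-pair φ ψ wφ wψ {n} m₁< u₁< m₂< u₂< le wχ =
        let (leφ , leψ) = ▷-bounds n (uniforms φ) (uniforms ψ) le
            n≤          = ▷-increasing n (uniforms φ)
            (cφ , wsφ)  = wφ n m₁< u₁< leφ
            (cψ , wsψ)  = wψ (n ▷ uniforms φ) (<-≤-trans m₂< n≤) (<-≤-trans u₂< n≤) leψ
        in (wχ , cφ , cψ) , ++⁺ wsφ wsψ

      wellNamed-op : ∀ o φ ψ → AllWellNamed φ → AllWellNamed ψ → ∀ n {m u} → m < n → u < n →
        2 + n ▷ (uniforms φ ++ uniforms ψ) ≤ N →
        WellNamed N (labelled o n u ∧ᴸ clause φ (2 + n) m n ∧ᴸ clause ψ (2 + n ▷ uniforms φ) m (1 + n))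
        × All (WellNamed N) (witnesses φ (2 + n) m n ++ witnesses ψ (2 + n ▷ uniforms φ) m (1 + n))
      wellNamed-op o φ ψ wφ wψ n m< u< le =
        wellNamed-pair φ ψ wφ wψ {χ = labelled o n _}
          (m<n⇒m<1+n (m<n⇒m<1+n m<)) (m<n⇒m<1+n (n<1+n n)) (m<n⇒m<1+n (m<n⇒m<1+n m<)) (n<1+n (suc n)) le
          ((<-≤-trans u< (≤-trans (n≤1+n n) (≤-trans (n≤1+n (1 + n)) 2+n≤))
            , ≤-trans (n≤1+n (1 + n)) 2+n≤ , 2+n≤) , tt)
        where
        2+n≤ : 2 + n ≤ N
        2+n≤ = ≤-trans (▷-increasing (2 + n) (uniforms φ ++ uniforms ψ)) le

      wellNamed : ∀ φ → (∀ {a} → a ∈ props φ → ∀ k → a ≢ f k) → AllWellNamed φ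
      wellNamed (pos a)  new n m< u< le =
        ⟹-wellNamed {χ = □[ _ ] flat (pos a)} (<-≤-trans m< le)
          ((<-≤-trans u< le , new (here refl)) , tt) , []
      wellNamed (neg a)  new n m< u< le =
        ⟹-wellNamed {χ = □[ _ ] flat (neg a)} (<-≤-trans m< le)
          ((<-≤-trans u< le , new (here refl)) , tt) , []
      wellNamed (A¹ φ)   new n m< u< le =
        ⟹-wellNamed {χ = □[ _ ] flat φ} (<-≤-trans m< le)
          ((<-≤-trans u< le , flat-wellNamed φ new) , tt) , []
      wellNamed ∼⊥       new n m< u< le =
        tt , (((<-≤-trans u< le , tt) , tt) , inside-wellNamed (<-≤-trans m< le)) ∷ []
      wellNamed (X φ)    new n m< u< le =
        let 1+n≤    = ≤-trans (▷-increasing (1 + n) (uniforms φ)) le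
            (c , ws) = wellNamed φ new (1 + n) (m<n⇒m<1+n m<) (n<1+n n) le
        in (((<-≤-trans u< (≤-trans (n≤1+n n) 1+n≤) , 1+n≤) , tt) , c) , ws
      wellNamed (φ ∧ ψ)  new = wellNamed-op and φ ψ
        (wellNamed φ (new ∘ ∈-++⁺ˡ)) (wellNamed ψ (new ∘ ∈-++⁺ʳ (props φ)))
      wellNamed (φ U ψ)  new = wellNamed-op until φ ψ
        (wellNamed φ (new ∘ ∈-++⁺ˡ)) (wellNamed ψ (new ∘ ∈-++⁺ʳ (props φ)))
      wellNamed (φ W ψ)  new = wellNamed-op weak φ ψ
        (wellNamed φ (new ∘ ∈-++⁺ˡ)) (wellNamed ψ (new ∘ ∈-++⁺ʳ (props φ)))
      wellNamed (φ ∨ᴮ ψ) new = wellNamed-op or φ ψ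
        (wellNamed φ (new ∘ ∈-++⁺ˡ)) (wellNamed ψ (new ∘ ∈-++⁺ʳ (props φ)))
      wellNamed (φ ∨ ψ)  new n {m} {u} m< u< le =
        wellNamed-pair φ ψ (wellNamed φ (new ∘ ∈-++⁺ˡ)) (wellNamed ψ (new ∘ ∈-++⁺ʳ (props φ)))
          {χ = splitting n m u}
          (m<n⇒m<1+n (n<1+n (2 + n))) (m<n⇒m<1+n (m<n⇒m<1+n (n<1+n (1 + n))))
          (n<1+n (3 + n)) (m<n⇒m<1+n (m<n⇒m<1+n (n<1+n (1 + n)))) le
          ( ((((<-≤-trans u< n≤ , 1+n≤) , tt)) , (tt , (1+n≤ , 2+n≤)))
          , ⟹-wellNamed {χ = inside (2 + n) ∨ᴸ inside (3 + n)} m<N (inside-wellNamed 3+n≤ , inside-wellNamed 4+n≤)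
          , ⟹-wellNamed {χ = inside m} 3+n≤ (inside-wellNamed m<N)
          , ⟹-wellNamed {χ = inside m} 4+n≤ (inside-wellNamed m<N))
        where
        4+n≤ : 4 + n ≤ N
        4+n≤ = ≤-trans (▷-increasing (4 + n) (uniforms φ ++ uniforms ψ)) le
        3+n≤ : 3 + n ≤ N
        3+n≤ = ≤-trans (n≤1+n (3 + n)) 4+n≤
        2+n≤ : 2 + n ≤ N
        2+n≤ = ≤-trans (n≤1+n (2 + n)) 3+n≤
        1+n≤ : 1 + n ≤ N
        1+n≤ = ≤-trans (n≤1+n (1 + n)) 2+n≤
        n≤ : n ≤ N
        n≤ = ≤-trans (n≤1+n n) 1+n≤
        m<N : m < N
        m<N = <-≤-trans m< n≤

    -- Closedness and the shape of the prefix.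

    at-scoped : ∀ {Γ π} χ → π ∈ Γ → ScopedBody Γ (at π χ)
    at-scoped (uni⁺ k)        π∈ = π∈
    at-scoped (uni⁻ k)        π∈ = π∈
    at-scoped (prop⁺ a)       π∈ = π∈
    at-scoped (prop⁻ a)       π∈ = π∈
    at-scoped tt              π∈ = π∈ , π∈
    at-scoped ff              π∈ = π∈ , π∈
    at-scoped (next χ)        π∈ = at-scoped χ π∈
    at-scoped (α ⟨ and ⟩ β)   π∈ = at-scoped α π∈ , at-scoped β π∈
    at-scoped (α ⟨ or ⟩ β)    π∈ = at-scoped α π∈ , at-scoped β π∈
    at-scoped (α ⟨ until ⟩ β) π∈ = at-scoped α π∈ , at-scoped β π∈
    at-scoped (α ⟨ weak ⟩ β)  π∈ = at-scoped α π∈ , at-scoped β π∈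

    close-scoped : ∀ ws {k Γ b χ} →
      (∀ Γ′ → (∀ {π} → π ∈ Γ → π ∈ Γ′) → ScopedBody Γ′ (matrix k ws χ) → ScopedBody Γ′ b) →
      Scoped Γ (close k ws b)
    close-scoped []       {χ = χ} scoped = scoped _ there (at-scoped χ (here refl))
    close-scoped (w ∷ ws) {χ = χ} scoped = close-scoped ws {χ = χ} λ Γ′ Γ⊆ h →
      scoped Γ′ (Γ⊆ ∘ there) (at-scoped w (Γ⊆ (here refl)) , h)

    quantify-scoped : ∀ qs {n Γ h} → Scoped Γ h → Scoped Γ (quantify qs n h)
    quantify-scoped []           sc = sc
    quantify-scoped (true ∷ qs)  sc = quantify-scoped qs sc
    quantify-scoped (false ∷ qs) sc = quantify-scoped qs sc

    uniform : Bool → Quantifier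
    uniform b = if b then ∃ᵘp else ∀ᵘp

    uniform-Uniform : ∀ qs → All Uniform (map uniform qs)
    uniform-Uniform []           = []
    uniform-Uniform (true ∷ qs)  = ∃ᵘp ∷ uniform-Uniform qs
    uniform-Uniform (false ∷ qs) = ∀ᵘp ∷ uniform-Uniform qs

    prefix-quantify : ∀ qs n h → prefix (quantify qs n h) ≡ map uniform qs ++ prefix h
    prefix-quantify []           n h = refl
    prefix-quantify (true ∷ qs)  n h = cong (∃ᵘp ∷_) (prefix-quantify qs (suc n) h)
    prefix-quantify (false ∷ qs) n h = cong (∀ᵘp ∷_) (prefix-quantify qs (suc n) h)

    prefix-close : ∀ k ws b → prefix (close k ws b) ≡ replicate (length ws) ∃π ++ [ ∀π ]
    prefix-close k []       b = refl
    prefix-close k (w ∷ ws) b = cong (∃π ∷_) (prefix-close (suc k) ws b)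

    -- Linear size.

    sizeᴸ : LTL → ℕ
    sizeᴸ (uni⁺ k)    = 1
    sizeᴸ (uni⁻ k)    = 1
    sizeᴸ (prop⁺ a)   = 1
    sizeᴸ (prop⁻ a)   = 1
    sizeᴸ tt          = 3
    sizeᴸ ff          = 3
    sizeᴸ (next χ)    = suc (sizeᴸ χ)
    sizeᴸ (α ⟨ o ⟩ β) = suc (sizeᴸ α + sizeᴸ β)

    size-at : ∀ π χ → sizeᴮ (at π χ) ≡ sizeᴸ χ
    size-at π (uni⁺ k)        = refl
    size-at π (uni⁻ k)        = refl
    size-at π (prop⁺ a)       = refl
    size-at π (prop⁻ a)       = refl
    size-at π tt              = refl
    size-at π ff              = refl
    size-at π (next χ)        = cong suc (size-at π χ)
    size-at π (α ⟨ and ⟩ β)   = cong suc (cong₂ _+_ (size-at π α) (size-at π β))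
    size-at π (α ⟨ or ⟩ β)    = cong suc (cong₂ _+_ (size-at π α) (size-at π β))
    size-at π (α ⟨ until ⟩ β) = cong suc (cong₂ _+_ (size-at π α) (size-at π β))
    size-at π (α ⟨ weak ⟩ β)  = cong suc (cong₂ _+_ (size-at π α) (size-at π β))

    -- A witness contributes a conjunct to the matrix and a quantifier ∃π.
    weight : List LTL → ℕ
    weight []       = 0
    weight (w ∷ ws) = 2 + sizeᴸ w + weight ws

    weight-++ : ∀ vs ws → weight (vs ++ ws) ≡ weight vs + weight ws
    weight-++ []       ws = refl
    weight-++ (v ∷ vs) ws =
      trans (cong (2 + sizeᴸ v +_) (weight-++ vs ws)) (sym (+-assoc (2 + sizeᴸ v) (weight vs) (weight ws)))

    size-close : ∀ k ws b → sizeᴴ (close k ws b) ≡ suc (length ws + sizeᴮ b)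
    size-close k []       b = refl
    size-close k (w ∷ ws) b = cong suc (size-close (suc k) ws b)

    size-matrix : ∀ k ws χ → length ws + sizeᴮ (matrix k ws χ) ≡ weight ws + sizeᴸ χ
    size-matrix k []       χ = size-at (g k) χ
    size-matrix k (w ∷ ws) χ =
      trans (cong suc (+-suc (length ws) _)) (cong (2 +_)
        (trans (+-assoc-comm (length ws) (sizeᴮ (at (g k) w)) (sizeᴮ (matrix (suc k) ws χ)))
          (trans (cong₂ _+_ (size-at (g k) w) (size-matrix (suc k) ws χ))
            (sym (+-assoc (sizeᴸ w) (weight ws) (sizeᴸ χ))))))
      where
      +-assoc-comm : ∀ a b c → a + (b + c) ≡ b + (a + c)
      +-assoc-comm a b c = trans (sym (+-assoc a b c)) (trans (cong (_+ c) (+-comm a b)) (+-assoc b a c))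

    size-quantify : ∀ qs n h → sizeᴴ (quantify qs n h) ≡ length qs + sizeᴴ h
    size-quantify []           n h = refl
    size-quantify (true ∷ qs)  n h = cong suc (size-quantify qs (suc n) h)
    size-quantify (false ∷ qs) n h = cong suc (size-quantify qs (suc n) h)

    size-uniforms : ∀ φ → length (uniforms φ) ≤ 4 * size φ

    size-uniforms-node : ∀ k φ ψ → k ≤ 4 →
      k + length (uniforms φ ++ uniforms ψ) ≤ 4 * suc (size φ + size ψ)
    size-uniforms-node k φ ψ k≤4 rewrite length-++ (uniforms φ) {uniforms ψ} =
      ≤-node 4 k (size φ) (size ψ) k≤4 (size-uniforms φ) (size-uniforms ψ)

    size-uniforms (pos a)  = z≤n
    size-uniforms (neg a)  = z≤n
    size-uniforms (φ ∨ ψ)  = size-uniforms-node 4 φ ψ ≤-refl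
    size-uniforms (φ ∧ ψ)  = size-uniforms-node 2 φ ψ (m≤m+n 2 2)
    size-uniforms (φ U ψ)  = size-uniforms-node 2 φ ψ (m≤m+n 2 2)
    size-uniforms (φ W ψ)  = size-uniforms-node 2 φ ψ (m≤m+n 2 2)
    size-uniforms (X φ)    = ≤-stem 4 1 (size φ) (m≤m+n 1 3) (size-uniforms φ)
    size-uniforms (φ ∨ᴮ ψ) = size-uniforms-node 2 φ ψ (m≤m+n 2 2)
    size-uniforms ∼⊥       = z≤n
    size-uniforms (A¹ φ)   = z≤n

    size-flat : ∀ φ → sizeᴸ (flat φ) ≤ 3 * size φ
    size-flat (pos a)  = m≤m+n 1 2
    size-flat (neg a)  = m≤m+n 1 2
    size-flat (φ ∨ ψ)  = ≤-trans (size-splitᴸ (onEmpty φ) (onEmpty ψ) (flat φ) (flat ψ))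
      (≤-node 3 1 (size φ) (size ψ) (m≤m+n 1 2) (size-flat φ) (size-flat ψ))
      where
      size-splitᴸ : ∀ a b α β → sizeᴸ (splitᴸ a b α β) ≤ suc (sizeᴸ α + sizeᴸ β)
      size-splitᴸ true  true  α β = ≤-refl
      size-splitᴸ true  false α β = m≤n⇒m≤1+n (m≤n+m (sizeᴸ β) (sizeᴸ α))
      size-splitᴸ false true  α β = m≤n⇒m≤1+n (m≤m+n (sizeᴸ α) (sizeᴸ β))
      size-splitᴸ false false α β = ≤-refl
    size-flat (φ ∧ ψ)  = ≤-node 3 1 (size φ) (size ψ) (m≤m+n 1 2) (size-flat φ) (size-flat ψ)
    size-flat (φ U ψ)  = ≤-node 3 1 (size φ) (size ψ) (m≤m+n 1 2) (size-flat φ) (size-flat ψ)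
    size-flat (φ W ψ)  = ≤-node 3 1 (size φ) (size ψ) (m≤m+n 1 2) (size-flat φ) (size-flat ψ)
    size-flat (X φ)    = ≤-stem 3 1 (size φ) (m≤m+n 1 2) (size-flat φ)
    size-flat (φ ∨ᴮ ψ) = ≤-node 3 1 (size φ) (size ψ) (m≤m+n 1 2) (size-flat φ) (size-flat ψ)
    size-flat ∼⊥       = ≤-refl
    size-flat (A¹ φ)   = ≤-stem 3 0 (size φ) z≤n (size-flat φ)

    -- The split is the costliest node: 15 for the challenge, 23, 15 and 15 for the three
    -- implications, and five conjunctions, 73 in all; 80 leaves some room.
    size-clause : ∀ φ n m u → sizeᴸ (clause φ n m u) ≤ 80 * size φ
    size-clause (pos a)  n m u = ≤ᵇ⇒≤ 15 80 tt
    size-clause (neg a)  n m u = ≤ᵇ⇒≤ 15 80 tt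
    size-clause (φ ∨ ψ)  n m u = ≤-node 80 73 (size φ) (size ψ) (≤ᵇ⇒≤ 73 80 tt) (size-clause φ _ _ _) (size-clause ψ _ _ _)
    size-clause (φ ∧ ψ)  n m u = ≤-node 80 11 (size φ) (size ψ) (≤ᵇ⇒≤ 11 80 tt) (size-clause φ _ _ _) (size-clause ψ _ _ _)
    size-clause (φ U ψ)  n m u = ≤-node 80 11 (size φ) (size ψ) (≤ᵇ⇒≤ 11 80 tt) (size-clause φ _ _ _) (size-clause ψ _ _ _)
    size-clause (φ W ψ)  n m u = ≤-node 80 11 (size φ) (size ψ) (≤ᵇ⇒≤ 11 80 tt) (size-clause φ _ _ _) (size-clause ψ _ _ _)
    size-clause (X φ)    n m u = ≤-stem 80 9 (size φ) (≤ᵇ⇒≤ 9 80 tt) (size-clause φ _ _ _)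
    size-clause (φ ∨ᴮ ψ) n m u = ≤-node 80 11 (size φ) (size ψ) (≤ᵇ⇒≤ 11 80 tt) (size-clause φ _ _ _) (size-clause ψ _ _ _)
    size-clause ∼⊥       n m u = ≤ᵇ⇒≤ 3 80 tt
    size-clause (A¹ φ)   n m u = ≤-trans (≤-reflexive (cong (11 +_) (+-comm (sizeᴸ (flat φ)) 3)))
      (≤-stem 80 14 (size φ) (≤ᵇ⇒≤ 14 80 tt) (≤-trans (size-flat φ) (*-monoˡ-≤ (size φ) (≤ᵇ⇒≤ 3 80 tt))))

    size-witnesses : ∀ φ n m u → weight (witnesses φ n m u) ≤ 20 * size φ

    size-witnesses-node : ∀ φ ψ n₁ m₁ u₁ n₂ m₂ u₂ →
      weight (witnesses φ n₁ m₁ u₁ ++ witnesses ψ n₂ m₂ u₂) ≤ 20 * suc (size φ + size ψ)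
    size-witnesses-node φ ψ n₁ m₁ u₁ n₂ m₂ u₂
      rewrite weight-++ (witnesses φ n₁ m₁ u₁) (witnesses ψ n₂ m₂ u₂) =
      ≤-node 20 0 (size φ) (size ψ) z≤n (size-witnesses φ n₁ m₁ u₁) (size-witnesses ψ n₂ m₂ u₂)

    size-witnesses (pos a)  n m u = z≤n
    size-witnesses (neg a)  n m u = z≤n
    size-witnesses (φ ∨ ψ)  n m u = size-witnesses-node φ ψ _ _ _ _ _ _
    size-witnesses (φ ∧ ψ)  n m u = size-witnesses-node φ ψ _ _ _ _ _ _
    size-witnesses (φ U ψ)  n m u = size-witnesses-node φ ψ _ _ _ _ _ _
    size-witnesses (φ W ψ)  n m u = size-witnesses-node φ ψ _ _ _ _ _ _
    size-witnesses (X φ)    n m u = ≤-stem 20 0 (size φ) z≤n (size-witnesses φ _ _ _)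
    size-witnesses (φ ∨ᴮ ψ) n m u = size-witnesses-node φ ψ _ _ _ _ _ _
    -- 17 for the witness formula, plus its conjunction and its quantifier.
    size-witnesses ∼⊥       n m u = ≤ᵇ⇒≤ 19 20 tt
    size-witnesses (A¹ φ)   n m u = z≤n

  size-positive : ∀ φ → 1 ≤ size φ
  size-positive (pos a)  = s≤s z≤n
  size-positive (neg a)  = s≤s z≤n
  size-positive (φ ∨ ψ)  = s≤s z≤n
  size-positive (φ ∧ ψ)  = s≤s z≤n
  size-positive (φ U ψ)  = s≤s z≤n
  size-positive (φ W ψ)  = s≤s z≤n
  size-positive (X φ)    = s≤s z≤n
  size-positive (φ ∨ᴮ ψ) = s≤s z≤n
  size-positive ∼⊥       = s≤s z≤n
  size-positive (A¹ φ)   = s≤s z≤n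

  -- Assembling the formula and its correctness.

  module Result (infiniteAP : Infinite AP) (infinite𝒱 : Infinite 𝒱) (φ : TeamLTL) where

    p : AP
    p = proj₁ (infiniteAP (props φ))

    p∉props : p ∉ props φ
    p∉props = proj₂ (infiniteAP (props φ))

    f : ℕ → AP
    f = name infiniteAP (p ∷ props φ)

    open Encoding p
    open Naming p f (name infinite𝒱 [])
      (name-distinct infiniteAP (p ∷ props φ)) (name-distinct infinite𝒱 [])
    open Overlays
    open Overlay

    prenex : List Bool
    prenex = true ∷ true ∷ uniforms φ

    N : ℕ
    N = 0 ▷ prenex

    ws : List LTL
    ws = witnesses φ 2 1 0

    -- Variable 0 holds the current position and variable 1 the whole team.
    χ : LTL
    χ = uni⁺ 0 ∧ᴸ inside 1 ∧ᴸ clause φ 2 1 0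

    φ* : HyperQPTL⁺
    φ* = ∃p · p ∙ quantify prenex 0 (close 0 ws (matrix 0 ws χ))

    closed : Closed φ*
    closed = quantify-scoped prenex (close-scoped ws {χ = χ} (λ _ _ h → h))

    prefix≡ : prefix φ* ≡ [ ∃p ] ++ map uniform prenex ++ replicate (length ws) ∃π ++ [ ∀π ]
    prefix≡ = cong (∃p ∷_) (trans (prefix-quantify prenex 0 _)
      (cong (map uniform prenex ++_) (prefix-close 0 ws _)))

    prefix-no-witness : ws ≡ [] → prefix φ* ≡ [ ∃p ] ++ map uniform prenex ++ [ ∀π ]
    prefix-no-witness ws≡[] = trans prefix≡
      (cong (λ vs → [ ∃p ] ++ map uniform prenex ++ replicate (length vs) ∃π ++ [ ∀π ]) ws≡[])

    prenex-uniform : All Uniform (map uniform prenex)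
    prenex-uniform = uniform-Uniform prenex

    no-witness : ∼⊥-Free φ → ws ≡ []
    no-witness free = ∼⊥-free⇒no-witnesses φ free 2 1 0

    -- Per unit of `size φ`, uniform quantifiers cost 4, witnesses 20 and clauses 80. The additive
    -- 14 counts `∃p`, two uniform quantifiers, `∀π` and the 10 symbols around the clause in `χ`; it
    -- is absorbed because sizes are positive.
    size≤ : sizeᴴ φ* ≤ 118 * size φ
    size≤ = begin
      sizeᴴ φ*
        ≡⟨ cong suc (trans (size-quantify prenex 0 _)
             (cong (length prenex +_) (trans (size-close 0 ws _) (cong suc (size-matrix 0 ws χ))))) ⟩
      3 + (length (uniforms φ) + suc (weight ws + (10 + sizeᴸ (clause φ 2 1 0))))
        ≤⟨ +-monoʳ-≤ 3 (+-mono-≤ (size-uniforms φ) (s≤s (+-mono-≤ (size-witnesses φ 2 1 0)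
             (+-monoʳ-≤ 10 (size-clause φ 2 1 0))))) ⟩
      3 + (4 * s + suc (20 * s + (10 + 80 * s)))
        ≡⟨ rearrange s ⟩
      14 * 1 + 104 * s
        ≤⟨ +-monoˡ-≤ (104 * s) (*-monoʳ-≤ 14 (size-positive φ)) ⟩
      14 * s + 104 * s
        ≡⟨ sym (*-distribʳ-+ s 14 104) ⟩
      118 * s ∎
      where
      open ≤-Reasoning
      s : ℕ
      s = size φ

      rearrange : ∀ s → 3 + (4 * s + suc (20 * s + (10 + 80 * s))) ≡ 14 * 1 + 104 * s
      rearrange = solve-∀

    p-new : ∀ k → p ≢ f k
    p-new k p≡ = name∉avoided infiniteAP (p ∷ props φ) k (here (sym p≡))

    props-new : ∀ {a} → a ∈ props φ → ∀ k → a ≢ f k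
    props-new a∈ k refl = name∉avoided infiniteAP (p ∷ props φ) k (there a∈)

    2≤N : 2 ≤ N
    2≤N = ▷-increasing 2 (uniforms φ)

    φ-wellNamed : WellNamed N (clause φ 2 1 0) × All (WellNamed N) ws
    φ-wellNamed = wellNamed p-new φ props-new 2 (s≤s (s≤s z≤n)) (s≤s z≤n) ≤-refl

    χ-wellNamed : WellNamed N χ
    χ-wellNamed = ≤-trans (n≤1+n 1) 2≤N , inside-wellNamed p-new 2≤N , proj₁ φ-wellNamed

    e₀ : Env
    e₀ _ _ = false

    module _ (T : TraceSet) (i : ℕ) where

      Goal : (Trace → Set) → Env → Set
      Goal B e = Everywhere e χ × All (Somewhere e) ws
        where open Evaluation i B

      φ*⇔ : ∀ {T′ Π B} → Overlays 0 e₀ B T′ →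
        (⟨ Π , i ⟩⊨[ T′ ] quantify prenex 0 (close 0 ws (matrix 0 ws χ))) ⇔ play prenex 0 (Goal B) e₀
      φ*⇔ {Π = Π} = quantify⇔ prenex {Π = Π} λ ovs → close⇔ ovs χ-wellNamed ws (proj₂ φ-wellNamed)

      correct : ⟨ ∅ , i ⟩⊨[ T ] φ* → ⟨ T , i ⟩⊨ φ
      correct (T′ , Π , variant , h) = conclude (to (φ*⇔ {Π = Π} same) h) (decide (Nonempty T′))
        where
        open Variant variant using () renaming (forth to variant-forth; back to variant-back)

        same : Overlays 0 e₀ (member T′) T′
        same .forth t t∈ = t , t∈ , record { new = λ _ () ; old = λ _ _ → refl }
        same .back  t t∈ = t , t∈ , record { new = λ _ () ; old = λ _ _ → refl }

        conclude : play prenex 0 (Goal (member T′)) e₀ → Dec (Nonempty T′) → ⟨ T , i ⟩⊨ φ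
        -- With `T′` empty, `∀π` says nothing. A demanded witness would be a trace of `T′`, so none
        -- is demanded and `φ` accepts the empty team.
        conclude (s , s′ , w) (no ∅T′) with play-outcome (uniforms φ) w
        ... | _ , _ , _ , some = from (onEmpty⇔ φ {T} ∅T i) (no-witnesses⇒onEmpty φ 2 1 0 (none some))
          where
          ∅T : ¬ Nonempty T
          ∅T (t , t∈) with variant-forth t t∈
          ... | t′ , t′∈ , _ = ∅T′ (t′ , t′∈)

          none : ∀ {vs e} → All (Evaluation.Somewhere i (member T′) e) vs → vs ≡ []
          none []                  = refl
          none ((t , t∈ , _) ∷ _) = contradiction (t , t∈) ∅T′
        conclude (s , s′ , w) (yes ne) with play-outcome (uniforms φ) w
        ... | e , le , every , _ =
          ⊨-resp-≐ φ {Team (e₂ 1)} {T} (proj₁ , whole)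
            (sound φ p∉props 2 1 0 e₂ (s≤s (s≤s z≤n)) (s≤s z≤n)
              (play-map (uniforms φ) (λ { e′ _ (every , some) →
                e′ , ⊑-refl , (λ t t∈ → proj₂ (proj₂ (every t t∈))) , λ _ → some }) w)
              i ≤-refl
              (trans (cong (λ s → s i) (le .agree (s≤s z≤n))) (proj₁ (every _ (proj₂ ne)))))
          where
          open Soundness i T T′ variant-forth variant-back ne
          open Evaluation i (member T′)

          e₂ : Env
          e₂ = e₀ [ 0 ≔ s ] [ 1 ≔ s′ ]

          whole : member T ⊆ member (Team (e₂ 1))
          whole {t} t∈ with variant-forth t t∈
          ... | t′ , t′∈ , t≈t′ = t∈ , t′ , t′∈ , t≈t′ ,
            subst (λ s → Inside s t′) (sym (le .agree (s≤s (s≤s z≤n))))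
              (inside⇒ {e} {t′} 1 (proj₁ (proj₂ (every t′ t′∈))))

      -- If `T` is empty, so is every variant of it, and a prefix with some `∃π` is false whatever
      -- `φ` says; hence the alternative in the first premise.
      complete : Nonempty T ⊎ ws ≡ [] → ⟨ T , i ⟩⊨ φ → ⟨ ∅ , i ⟩⊨[ T ] φ*
      complete witnessed h =
        T′ , ∅ , variant , from (φ*⇔ {T′} {∅} same)
          (here-now , column 0 ,
            play-map (uniforms φ) (λ e′ le r → finish e′ le (r e′ ⊑-refl))
              (proj₂ plan F (λ b → suc b , refl) 2 1 0 e₂ (s≤s (s≤s z≤n)) (s≤s z≤n) rep
                (λ j _ j≡i → subst (λ k → ⟨ T , k ⟩⊨ φ) (sym (does⇒ (j ≟ i) j≡i)) h)))
        where
        open Completeness i T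

        plan : Strategic φ T
        plan = strategic φ p∉props T id

        F : ℕ → TraceSet
        -- Column 0 is reserved for the whole team; the teams of the plan move up by one.
        F = T ◂ proj₁ plan

        open Strategy F
        open Evaluation i (Encoded F)

        T′ : TraceSet
        T′ .member u = ∃[ t ] member T t × u ≈ encode F t
        T′ .respects eq (t , t∈ , u≈) = t , t∈ , λ r q → trans (sym (eq r q)) (u≈ r q)

        variant : Variant p T ∅ T′ ∅
        variant = record
          { into     = λ _ → nothing
          ; forth    = λ t t∈ → encode F t , (t , t∈ , λ _ _ → refl) ,
                         λ r q q≢p → sym (↦-other t {p} {stored F t} r q≢p)
          ; back     = λ { u (t , t∈ , u≈) → t , t∈ ,
                         λ r q q≢p → sym (trans (u≈ r q) (↦-other t {p} {stored F t} r q≢p)) }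
          ; assigned = λ _ → nothing
          }

        same : Overlays 0 e₀ (Encoded F) T′
        same .forth _ (t , t∈ , refl) =
          encode F t , (t , t∈ , λ _ _ → refl) , record { new = λ _ () ; old = λ _ _ → refl }
        same .back u (t , t∈ , u≈) =
          encode F t , (t , t∈ , refl) , record { new = λ _ () ; old = λ r _ → u≈ r _ }

        here-now : ℕ → Bool
        here-now j = does (j ≟ i)

        e₂ : Env
        e₂ = e₀ [ 0 ≔ here-now ] [ 1 ≔ column 0 ]

        rep : Represents (e₂ 1) T
        rep = column-represents 0 refl

        some-witness : Satisfiable (Encoded F) ⊎ ws ≡ []
        some-witness = Sum.map₁ (λ (t , t∈) → encode F t , t , t∈ , refl) witnessed

        finish : ∀ e′ → e₂ ⊑[ 2 ] e′ → Wins φ 2 1 0 e′ → Goal (Encoded F) e′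
        finish e′ le (every , some) =
          (λ { _ (t , t∈ , refl) →
               trans (cong (λ s → s i) (sym (le .agree (s≤s z≤n)))) (dec-true (i ≟ i) refl)
             , inside⇐ {e′} {encode F t} 1
                 (subst (λ s → Inside s (encode F t)) (le .agree (s≤s (s≤s z≤n))) (from (rep t t∈) t∈))
             , every _ (t , t∈ , refl) }) ,
          Sum.[ some , (λ eq → subst (All (Somewhere e′)) (sym eq) []) ]′ some-witness

theorem6 : ExcludedMiddle (lsuc 0ℓ) →
    (AP 𝒱 : Set) (_≟ᴬ_ : DecidableEquality AP) (_≟ⱽ_ : DecidableEquality 𝒱) →
    Infinite AP → Infinite 𝒱 →
    let open Logic AP 𝒱 _≟ᴬ_ _≟ⱽ_ in
    ∃[ c ] ((φ : TeamLTL) →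
    (∃[ φ* ] ∃ₚQᵘₚ*∃π*∀π φ* × Closed φ* × sizeᴴ φ* ≤ c * size φ
    × ((T : TraceSet) (i : ℕ) →
    ((⟨ ∅ , i ⟩⊨[ T ] φ*) → (⟨ T , i ⟩⊨ φ))
    × (Nonempty T → (⟨ T , i ⟩⊨ φ) → (⟨ ∅ , i ⟩⊨[ T ] φ*))))
    × (∼⊥-Free φ →
    ∃[ φ* ] ∃ₚQᵘₚ*∀π φ* × Closed φ* × sizeᴴ φ* ≤ c * size φ
    × ((T : TraceSet) (i : ℕ) → (⟨ T , i ⟩⊨ φ) ⇔ (⟨ ∅ , i ⟩⊨[ T ] φ*))))
theorem6 em AP 𝒱 _≟ᴬ_ _≟ⱽ_ infiniteAP infinite𝒱 = 118 , λ φ →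
  let open Translation em AP 𝒱 _≟ᴬ_ _≟ⱽ_
      open Result infiniteAP infinite𝒱 φ
  in
  ( φ* , (_ , _ , prenex-uniform , prefix≡) , closed , size≤
  , λ T i → correct T i , λ ne → complete T i (inj₁ ne)) ,
  λ free →
  φ* , (_ , prenex-uniform , prefix-no-witness (no-witness free)) , closed , size≤
  , λ T i → mk⇔ (complete T i (inj₂ (no-witness free))) (correct T i)
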